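{- If $M$ is a term of $\ell\Lambda_\infty^{4S}$, $M\Rightarrow N$ and $M\Rightarrow L$, then there is a term $P$ of $\ell\Lambda_\infty^{4S}$ such that $N\Rightarrow P$ and $L\Rightarrow P$.
   Context: Preterms: possibly infinite trees generated by $M ::= x \mid MN \mid \lambda x.M \mid \lambda^{\downarrow}x.M \mid \lambda^{\uparrow}x.M \mid \downarrow M \mid \uparrow M$ ($\downarrow M$ inductive box, $\uparrow M$ coinductive box); substitution is capture-avoiding. Patterns: $x,\downarrow x,\uparrow x,\#x,\dagger x$; environments: finite sets of patterns, each variable in at most one; $\Theta,\Xi,\Psi,\Phi$ linear environments with marked versions $\#\Theta$ etc.; $\Upsilon,\Pi$ environments with only patterns $y$, $\downarrow y$; commas are disjoint unions. A term of $\ell\Lambda_\infty^{4S}$ is a preterm $M$ with $\Gamma\vdash M$ derivable for some $\Gamma$ by: (vl) $\#\Theta,\uparrow\Xi,\dagger\Psi,x\vdash x$; (vd) $\#\Theta,\uparrow\Xi,\dagger\Psi,\#x\vdash x$; (va) $\#\Theta,\uparrow\Xi,\dagger\Psi,\dagger x\vdash x$; (a) from $\Upsilon,\#\Theta,\uparrow\Xi,\dagger\Psi\vdash M$ and $\Pi,\#\Theta,\uparrow\Xi,\dagger\Psi\vdash N$ infer $\Upsilon,\Pi,\#\Theta,\uparrow\Xi,\dagger\Psi\vdash MN$; (ll) $\Gamma,x\vdash M$ gives $\Gamma\vdash\lambda x.M$; (li)$_1$ $\Gamma,\#x\vdash M$ gives $\Gamma\vdash\lambda^\downarrow x.M$;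 (li)$_2$ $\Gamma,\downarrow x\vdash M$ gives $\Gamma\vdash\lambda^\downarrow x.M$; (lc) $\Gamma,\uparrow x\vdash M$ gives $\Gamma\vdash\lambda^\uparrow x.M$; (mi) from $\Xi,\uparrow\Psi,\dagger\Phi\vdash M$ infer $\#\Theta,\downarrow\Xi,\uparrow\Psi,\dagger\Phi\vdash\downarrow M$; (mc) from $\dagger\Xi,\dagger\Psi\vdash M$ infer $\#\Theta,\uparrow\Xi,\dagger\Psi\vdash\uparrow M$; (mc) coinductive, others inductive (every infinite branch of a derivation contains infinitely many (mc)). Basic reduction: $(\lambda x.M)N\mapsto M[N/x]$, $(\lambda^\downarrow x.M)(\downarrow N)\mapsto M[N/x]$, $(\lambda^\uparrow x.M)(\uparrow N)\mapsto M[N/x]$; $M\to N$ iff $M=C[L]$, $N=C[P]$, $L\mapsto P$ for a one-hole context $C$. Infinitary reduction $\Rightarrow$ and auxiliary $\leadsto$ are given by the mixed formal system: (coinductive rule) if $M\to^*N$ and $N\leadsto L$ then $M\Rightarrow L$; (inductive rules) $x\leadsto x$; if $M\leadsto N$ and $L\leadsto P$ then $ML\leadsto NP$; if $M\leadsto N$ then $\lambda x.M\leadsto\lambda x.N$, $\lambda^\downarrow x.M\leadsto\lambda^\downarrow x.N$, $\lambda^\uparrow x.M\leadsto\lambda^\uparrow x.N$ and $\downarrow M\leadsto\downarrow N$; if $M\Rightarrow N$ then $\uparrow M\leadsto\uparrow N$. A judgment holds iff it is the root of a possibly infinite derivation tree in which every infinite branch uses the coinductive rule infinitely often. -}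

module Defs where

open import Data.List using (List; []; _∷_)
open import Data.Maybe using (Maybe; just; nothing; _>>=_)
open import Data.Nat using (ℕ; zero; suc)
open import Data.Product using (∃-syntax; _×_)
open import Level using (Level; 0ℓ)
open import Relation.Binary.Construct.Closure.ReflexiveTransitive using (Star)
open import Relation.Binary.Core using (REL; Rel)
open import Relation.Binary.PropositionalEquality using (_≡_; _≢_)

-- Greatest fixed point of a monotone operator on relations: the pair (a , b)
-- lies in some R with R ⊆ F R.  A proof of R x y is a node of a possibly infinite
-- derivation tree, labelled by the judgment (x , y), and unfolds to one layer
-- of that tree.  When F R is an inductive family using R in the premises of
-- certain rules only (the coinductive ones), every infinite branch of the tree
-- goes through these rules infinitely often.

ν : {A B : Set} → (REL A B 0ℓ → REL A B 0ℓ) → A → B → Set₁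
ν F a b = ∃[ R ] (∀ {x y} → R x y → F R x y) × R a b

-- Possibly infinite trees, as labellings of paths from the root.  Variables are
-- de Bruijn indices, so that preterms are taken up to α-conversion.  A node with
-- one child uses only the direction left.  Labels at paths that are not positions
-- of the tree (below a variable, or to the right of a unary node) are junk,
-- ignored by `at` and hence by tree equality `_≈_`.

data Symbol : Set where
  var  : ℕ → Symbol
  app lam lam↓ lam↑ box↓ box↑ : Symbol

data Direction : Set where
  left right : Direction

Path : Set
Path = List Direction

Preterm : Set
Preterm = Path → Symbol

subtree : Direction → Preterm → Preterm
subtree d M p = M (d ∷ p)

data Node : Set where
  var  : ℕ → Node
  app  : Preterm → Preterm → Node
  lam  : Preterm → Node
  lam↓ : Preterm → Node
  lam↑ : Preterm → Node
  box↓ : Preterm → Node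
  box↑ : Preterm → Node

out : Preterm → Node
out M with M []
... | var i = var i
... | app   = app (subtree left M) (subtree right M)
... | lam   = lam (subtree left M)
... | lam↓  = lam↓ (subtree left M)
... | lam↑  = lam↑ (subtree left M)
... | box↓  = box↓ (subtree left M)
... | box↑  = box↑ (subtree left M)

fold : Node → Preterm
fold (var i)   _           = var i
fold (app M N) []          = app
fold (app M N) (left ∷ p)  = M p
fold (app M N) (right ∷ p) = N p
fold (lam M)   []          = lam
fold (lam M)   (_ ∷ p)     = M p
fold (lam↓ M)  []          = lam↓
fold (lam↓ M)  (_ ∷ p)     = M p
fold (lam↑ M)  []          = lam↑
fold (lam↑ M)  (_ ∷ p)     = M p
fold (box↓ M)  []          = box↓
fold (box↓ M)  (_ ∷ p)     = M p
fold (box↑ M)  []          = box↑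
fold (box↑ M)  (_ ∷ p)     = M p

child : Direction → Node → Maybe Preterm
child _     (var i)   = nothing
child left  (app M N) = just M
child right (app M N) = just N
child left  (lam M)   = just M
child left  (lam↓ M)  = just M
child left  (lam↑ M)  = just M
child left  (box↓ M)  = just M
child left  (box↑ M)  = just M
child right _         = nothing

at : Preterm → Path → Maybe Symbol
at M []      = just (M [])
at M (d ∷ p) = child d (out M) >>= λ K → at K p

infix 4 _≈_

_≈_ : Preterm → Preterm → Set
M ≈ N = ∀ p → at M p ≡ at N p

ext : (ℕ → ℕ) → ℕ → ℕ
ext ρ zero    = zero
ext ρ (suc i) = suc (ρ i)

mutual
  rename : (ℕ → ℕ) → Preterm → Preterm
  rename ρ M p = renameᴺ ρ (out M) p

  renameᴺ : (ℕ → ℕ) → Node → Preterm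
  renameᴺ ρ (var i)   _           = var (ρ i)
  renameᴺ ρ (app M N) []          = app
  renameᴺ ρ (app M N) (left ∷ p)  = rename ρ M p
  renameᴺ ρ (app M N) (right ∷ p) = rename ρ N p
  renameᴺ ρ (lam M)   []          = lam
  renameᴺ ρ (lam M)   (_ ∷ p)     = rename (ext ρ) M p
  renameᴺ ρ (lam↓ M)  []          = lam↓
  renameᴺ ρ (lam↓ M)  (_ ∷ p)     = rename (ext ρ) M p
  renameᴺ ρ (lam↑ M)  []          = lam↑
  renameᴺ ρ (lam↑ M)  (_ ∷ p)     = rename (ext ρ) M p
  renameᴺ ρ (box↓ M)  []          = box↓
  renameᴺ ρ (box↓ M)  (_ ∷ p)     = rename ρ M p
  renameᴺ ρ (box↑ M)  []          = box↑
  renameᴺ ρ (box↑ M)  (_ ∷ p)     = rename ρ M p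

exts : (ℕ → Preterm) → ℕ → Preterm
exts σ zero    = fold (var zero)
exts σ (suc i) = rename suc (σ i)

mutual
  subst : (ℕ → Preterm) → Preterm → Preterm
  subst σ M p = substᴺ σ (out M) p

  substᴺ : (ℕ → Preterm) → Node → Preterm
  substᴺ σ (var i)   p           = σ i p
  substᴺ σ (app M N) []          = app
  substᴺ σ (app M N) (left ∷ p)  = subst σ M p
  substᴺ σ (app M N) (right ∷ p) = subst σ N p
  substᴺ σ (lam M)   []          = lam
  substᴺ σ (lam M)   (_ ∷ p)     = subst (exts σ) M p
  substᴺ σ (lam↓ M)  []          = lam↓
  substᴺ σ (lam↓ M)  (_ ∷ p)     = subst (exts σ) M p
  substᴺ σ (lam↑ M)  []          = lam↑
  substᴺ σ (lam↑ M)  (_ ∷ p)     = subst (exts σ) M p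
  substᴺ σ (box↓ M)  []          = box↓
  substᴺ σ (box↓ M)  (_ ∷ p)     = subst σ M p
  substᴺ σ (box↑ M)  []          = box↑
  substᴺ σ (box↑ M)  (_ ∷ p)     = subst σ M p

-- Substitution for the variable 0; the other variables are shifted down, since
-- the binder disappears.

single : Preterm → ℕ → Preterm
single N zero    = N
single N (suc i) = fold (var i)

_[_] : Preterm → Preterm → Preterm
M [ N ] = subst (single N) M

-- The patterns x, ↓x, ↑x, #x, †x.  The i-th entry of an environment is the
-- pattern in which the variable i occurs, `nothing` if it occurs in none.

data Pattern : Set where
  lin ↓ ↑ # † : Pattern

Env : Set
Env = List (Maybe Pattern)

_‼_ : Env → ℕ → Maybe Pattern
[]      ‼ _     = nothing
(π ∷ Γ) ‼ zero  = π
(π ∷ Γ) ‼ suc i = Γ ‼ i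

-- Entries of an environment #Θ,↑Ξ,†Ψ.

data Shared : Maybe Pattern → Set where
  none : Shared nothing
  #Θ   : Shared (just #)
  ↑Ξ   : Shared (just ↑)
  †Ψ   : Shared (just †)

-- Entries of the environments of rule (a), in the order
-- Υ,#Θ,↑Ξ,†Ψ (left premise); Π,#Θ,↑Ξ,†Ψ (right premise); Υ,Π,#Θ,↑Ξ,†Ψ.

data Split : Maybe Pattern → Maybe Pattern → Maybe Pattern → Set where
  linΥ   : Split (just lin) nothing    (just lin)
  ↓Υ     : Split (just ↓)   nothing    (just ↓)
  linΠ   : Split nothing    (just lin) (just lin)
  ↓Π     : Split nothing    (just ↓)   (just ↓)
  shared : ∀ {π} → Shared π → Split π π π

-- Entries of the environments Ξ,↑Ψ,†Φ (premise) and #Θ,↓Ξ,↑Ψ,†Φ (conclusion)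
-- of rule (mi).

data Under↓ : Maybe Pattern → Maybe Pattern → Set where
  none : Under↓ nothing    nothing
  #Θ   : Under↓ nothing    (just #)
  ↓Ξ   : Under↓ (just lin) (just ↓)
  ↑Ψ   : Under↓ (just ↑)   (just ↑)
  †Φ   : Under↓ (just †)   (just †)

-- Entries of the environments †Ξ,†Ψ (premise) and #Θ,↑Ξ,†Ψ (conclusion) of
-- rule (mc).

data Under↑ : Maybe Pattern → Maybe Pattern → Set where
  none : Under↑ nothing  nothing
  #Θ   : Under↑ nothing  (just #)
  ↑Ξ   : Under↑ (just †) (just ↑)
  †Ψ   : Under↑ (just †) (just †)

infix 4 ⟨_⟩_⊢_ _⊢_

-- The formation rules, with the premise of the coinductive rule (mc) taken in R.

data ⟨_⟩_⊢_ {ℓ : Level} (R : REL Env Preterm ℓ) (Γ : Env) : Node → Set ℓ where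
  vl  : ∀ {i} → Γ ‼ i ≡ just lin →
        (∀ j → j ≢ i → Shared (Γ ‼ j)) → ⟨ R ⟩ Γ ⊢ var i
  vd  : ∀ {i} → Γ ‼ i ≡ just # →
        (∀ j → j ≢ i → Shared (Γ ‼ j)) → ⟨ R ⟩ Γ ⊢ var i
  va  : ∀ {i} → Γ ‼ i ≡ just † →
        (∀ j → j ≢ i → Shared (Γ ‼ j)) → ⟨ R ⟩ Γ ⊢ var i
  ap  : ∀ {M N} (Γ₁ Γ₂ : Env) →
        (∀ j → Split (Γ₁ ‼ j) (Γ₂ ‼ j) (Γ ‼ j)) →
        ⟨ R ⟩ Γ₁ ⊢ out M → ⟨ R ⟩ Γ₂ ⊢ out N → ⟨ R ⟩ Γ ⊢ app M N
  ll  : ∀ {M} → ⟨ R ⟩ (just lin ∷ Γ) ⊢ out M → ⟨ R ⟩ Γ ⊢ lam M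
  li₁ : ∀ {M} → ⟨ R ⟩ (just # ∷ Γ) ⊢ out M → ⟨ R ⟩ Γ ⊢ lam↓ M
  li₂ : ∀ {M} → ⟨ R ⟩ (just ↓ ∷ Γ) ⊢ out M → ⟨ R ⟩ Γ ⊢ lam↓ M
  lc  : ∀ {M} → ⟨ R ⟩ (just ↑ ∷ Γ) ⊢ out M → ⟨ R ⟩ Γ ⊢ lam↑ M
  mi  : ∀ {M} (Δ : Env) → (∀ j → Under↓ (Δ ‼ j) (Γ ‼ j)) →
        ⟨ R ⟩ Δ ⊢ out M → ⟨ R ⟩ Γ ⊢ box↓ M
  mc  : ∀ {M} (Δ : Env) → (∀ j → Under↑ (Δ ‼ j) (Γ ‼ j)) →
        R Δ M → ⟨ R ⟩ Γ ⊢ box↑ M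

_⊢_ : Env → Preterm → Set₁
_⊢_ = ν λ R Γ M → ⟨ R ⟩ Γ ⊢ out M

IsTerm : Preterm → Set₁
IsTerm M = ∃[ Γ ] Γ ⊢ M

infix 4 _↦_ _⟶_ _⟶*_ ⟨_⟩_⇝_ _⇒_ _⇝_

data _↦_ : Rel Preterm 0ℓ where
  β  : ∀ {M N} → fold (app (fold (lam M)) N) ↦ M [ N ]
  β↓ : ∀ {M N} → fold (app (fold (lam↓ M)) (fold (box↓ N))) ↦ M [ N ]
  β↑ : ∀ {M N} → fold (app (fold (lam↑ M)) (fold (box↑ N))) ↦ M [ N ]

data Context : Set where
  □    : Context
  appˡ : Context → Preterm → Context
  appʳ : Preterm → Context → Context
  lam  : Context → Context
  lam↓ : Context → Context
  lam↑ : Context → Context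
  box↓ : Context → Context
  box↑ : Context → Context

plug : Context → Preterm → Preterm
plug □          L = L
plug (appˡ C N) L = fold (app (plug C L) N)
plug (appʳ M C) L = fold (app M (plug C L))
plug (lam C)    L = fold (lam (plug C L))
plug (lam↓ C)   L = fold (lam↓ (plug C L))
plug (lam↑ C)   L = fold (lam↑ (plug C L))
plug (box↓ C)   L = fold (box↓ (plug C L))
plug (box↑ C)   L = fold (box↑ (plug C L))

_⟶_ : Rel Preterm 0ℓ
M ⟶ N = ∃[ C ] ∃[ L ] ∃[ P ] M ≈ plug C L × N ≈ plug C P × L ↦ P

-- The last factor makes zero steps reflexive with respect to tree equality.

_⟶*_ : Rel Preterm 0ℓ
M ⟶* N = ∃[ K ] Star _⟶_ M K × K ≈ N

-- The inductive rules, with the premise M ⇒ N of the box↑ rule taken in R.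

data ⟨_⟩_⇝_ {ℓ : Level} (R : Rel Preterm ℓ) : Node → Node → Set ℓ where
  var  : ∀ {i} → ⟨ R ⟩ var i ⇝ var i
  app  : ∀ {M N L P} → ⟨ R ⟩ out M ⇝ out N → ⟨ R ⟩ out L ⇝ out P →
         ⟨ R ⟩ app M L ⇝ app N P
  lam  : ∀ {M N} → ⟨ R ⟩ out M ⇝ out N → ⟨ R ⟩ lam M ⇝ lam N
  lam↓ : ∀ {M N} → ⟨ R ⟩ out M ⇝ out N → ⟨ R ⟩ lam↓ M ⇝ lam↓ N
  lam↑ : ∀ {M N} → ⟨ R ⟩ out M ⇝ out N → ⟨ R ⟩ lam↑ M ⇝ lam↑ N
  box↓ : ∀ {M N} → ⟨ R ⟩ out M ⇝ out N → ⟨ R ⟩ box↓ M ⇝ box↓ N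
  box↑ : ∀ {M N} → R M N → ⟨ R ⟩ box↑ M ⇝ box↑ N

_⇒_ : Preterm → Preterm → Set₁
_⇒_ = ν λ R M L → ∃[ N ] M ⟶* N × ⟨ R ⟩ out N ⇝ out L

_⇝_ : Preterm → Preterm → Set₁
M ⇝ N = ⟨ _⇒_ ⟩ out M ⇝ out N

{-# OPTIONS --safe #-}
module Submission where

-- Let ⇛ be parallel reduction outside the coinductive boxes.  By the formation rules
-- a variable bound by λ or λ↓ does not occur in a coinductive box of its scope, and
-- one bound by λ↑ occurs only there.  Hence contracting a redex outside the boxes
-- never brings the contents of a box to the surface, nor a reducible surface term
-- into a box.  So ⇛ has the diamond property on terms, it commutes with ⇝, and
-- surface steps can be moved in front of steps inside boxes: M ⇒ N amounts to
-- M ⇛* E ⇝ N, coinductively in the boxes, written M ⇒ˢ N.  A peak N ⇐ M ⇒ L can then be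
-- closed at the surface, which leaves terms J ⇝ N₁ and J ⇝ L₁ with N ⇛* N₁ and
-- L ⇛* L₁, and is closed corecursively in the boxes of J.

open import Defs
open import Data.Empty using (⊥; ⊥-elim)
open import Data.List using ([]; _∷_)
open import Data.Maybe using (Maybe; just; nothing; _>>=_)
open import Data.Nat using (ℕ; zero; suc)
open import Data.Nat.Properties using (suc-injective)
open import Data.Product using (∃-syntax; Σ-syntax; _×_; _,_; proj₁; proj₂)
open import Data.Sum using (_⊎_; inj₁; inj₂)
open import Data.Unit using (⊤; tt)
open import Function using (_∘_)
open import Level using (Level; 0ℓ; _⊔_) renaming (suc to lsuc)
open import Relation.Binary.Construct.Closure.ReflexiveTransitive using (Star; ε; _◅_; _◅◅_; gmap)
open import Relation.Binary.Core using (REL; Rel)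
open import Relation.Binary.PropositionalEquality using (_≡_; _≢_; refl; sym; trans; cong; subst₂) renaming (subst to transport)

-- The formation derivation is the measure of the recursions: between two (mc) rules it is well
-- founded although preterms are infinite, so facts about the surface go by induction on it, and
-- (mc) is where they turn corecursive. The obstacle is productivity: the prefix ⟶* of ⇒ may act at
-- any depth, and composing or closing reductions with such prefixes would mean looking into a box
-- before its surroundings are settled. In ⇒ˢ the prefix stays on the surface, so each step settles
-- a finite layer and leaves one problem of the same shape to each box. Typing survives because
-- reduction changes an environment only from ↓ to #, and the environment of the contents of a box
-- has no ↓; so the limit of a reduction can be typed layer by layer. Trees being functions on
-- paths, equality is `≈` throughout: the relations are built to be invariant under it.

-- Coinduction

-- The witness in ν has to be a small relation, whereas the invariants below mention ν
-- itself and are large.  A derivation layer with premises in S uses only a small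
-- family of them, so the judgments reachable from a given one form a small relation.

record Supported {A B : Set} (G : REL A B 0ℓ → Set) (S : REL A B (lsuc 0ℓ)) : Set₁ where
  constructor supported
  field
    Index   : Set
    source  : Index → A
    target  : Index → B
    premise : ∀ i → S (source i) (target i)
    rebuild : ∀ {R} → (∀ i → R (source i) (target i)) → G R

open Supported

module Small {A B : Set} (F : REL A B 0ℓ → REL A B 0ℓ) (S : REL A B (lsuc 0ℓ))
             (step : ∀ {a b} → S a b → Supported (λ R → F R a b) S)
             {a₀ : A} {b₀ : B} (s₀ : S a₀ b₀) where

  Judgment : Set₁
  Judgment = ∃[ a ] ∃[ b ] S a b

  -- An inductive family of reached judgments would store elements of S and be large. Recursion on
  -- the depth n gives the nodes at that depth a small index type, with their judgments attached by
  -- a function.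
  level : ℕ → Σ[ I ∈ Set ] (I → Judgment)
  level zero    = ⊤ , λ _ → a₀ , b₀ , s₀
  level (suc n) = let I , judgment = level n; premises x = step (proj₂ (proj₂ (judgment x))) in
    (Σ[ x ∈ I ] Index (premises x)) ,
    λ (x , i) → source (premises x) i , target (premises x) i , premise (premises x) i

  Reached : REL A B 0ℓ
  Reached a b = ∃[ n ] Σ[ x ∈ proj₁ (level n) ]
    (proj₁ (proj₂ (level n) x) ≡ a × proj₁ (proj₂ (proj₂ (level n) x)) ≡ b)

  reached-step : ∀ {a b} → Reached a b → F Reached a b
  reached-step (n , x , refl , refl) =
    rebuild (step (proj₂ (proj₂ (proj₂ (level n) x)))) λ i → suc n , (x , i) , refl , refl

ν-coinduction : ∀ {A B : Set} {F : REL A B 0ℓ → REL A B 0ℓ} (S : REL A B (lsuc 0ℓ)) →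
                (∀ {a b} → S a b → Supported (λ R → F R a b) S) →
                ∀ {a b} → S a b → ν F a b
ν-coinduction {F = F} S step s = Reached , reached-step , zero , tt , refl , refl
  where open Small F S step s

module _ {A B : Set} {S : REL A B (lsuc 0ℓ)} where

  support-⊥ : ∀ {G : REL A B 0ℓ → Set} → (∀ {R} → G R) → Supported G S
  support-⊥ g = supported ⊥ (λ ()) (λ ()) (λ ()) λ _ → g

  support-leaf : ∀ {a b} → S a b → Supported (λ R → R a b) S
  support-leaf s = supported ⊤ _ _ (λ _ → s) λ r → r tt

  support-map : ∀ {G H : REL A B 0ℓ → Set} → (∀ {R} → G R → H R) → Supported G S → Supported H S
  support-map f (supported I a b s r) = supported I a b s λ h → f (r h)

  support-× : ∀ {G H : REL A B 0ℓ → Set} →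
              Supported G S → Supported H S → Supported (λ R → G R × H R) S
  support-× (supported I a b s r) (supported I′ a′ b′ s′ r′) =
    supported (I ⊎ I′)
      (λ { (inj₁ i) → a i ; (inj₂ i) → a′ i })
      (λ { (inj₁ i) → b i ; (inj₂ i) → b′ i })
      (λ { (inj₁ i) → s i ; (inj₂ i) → s′ i })
      λ h → r (λ i → h (inj₁ i)) , r′ (λ i → h (inj₂ i))

-- Tree equality and substitution

data Layer {ℓ : Level} (R : Rel Preterm ℓ) : Rel Node ℓ where
  var  : ∀ {i} → Layer R (var i) (var i)
  app  : ∀ {M N M′ N′} → R M M′ → R N N′ → Layer R (app M N) (app M′ N′)
  lam  : ∀ {M M′} → R M M′ → Layer R (lam M) (lam M′)
  lam↓ : ∀ {M M′} → R M M′ → Layer R (lam↓ M) (lam↓ M′)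
  lam↑ : ∀ {M M′} → R M M′ → Layer R (lam↑ M) (lam↑ M′)
  box↓ : ∀ {M M′} → R M M′ → Layer R (box↓ M) (box↓ M′)
  box↑ : ∀ {M M′} → R M M′ → Layer R (box↑ M) (box↑ M′)

infix 4 _≈ᴺ_

_≈ᴺ_ : Rel Node 0ℓ
_≈ᴺ_ = Layer _≈_

Layer-map : ∀ {ℓ ℓ′} {R : Rel Preterm ℓ} {S : Rel Preterm ℓ′} →
            (∀ {M N} → R M N → S M N) → ∀ {m n} → Layer R m n → Layer S m n
Layer-map f var       = var
Layer-map f (app r s) = app (f r) (f s)
Layer-map f (lam r)   = lam (f r)
Layer-map f (lam↓ r)  = lam↓ (f r)
Layer-map f (lam↑ r)  = lam↑ (f r)
Layer-map f (box↓ r)  = box↓ (f r)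
Layer-map f (box↑ r)  = box↑ (f r)

≈⇒≈ᴺ : ∀ {M N} → M ≈ N → out M ≈ᴺ out N
-- The equalities at longer paths have types that mention the root labels, so they are abstracted
-- together with these.
≈⇒≈ᴺ {M} {N} h with M [] | N [] | h [] | (λ p → h (left ∷ p)) | (λ p → h (right ∷ p))
... | var _ | var _ | refl | _ | _ = var
... | app   | app   | _ | l | r = app l r
... | lam   | lam   | _ | l | _ = lam l
... | lam↓  | lam↓  | _ | l | _ = lam↓ l
... | lam↑  | lam↑  | _ | l | _ = lam↑ l
... | box↓  | box↓  | _ | l | _ = box↓ l
... | box↑  | box↑  | _ | l | _ = box↑ l

label : Node → Symbol
label n = fold n []

out-fold : ∀ n → out (fold n) ≡ n
out-fold (var i)   = refl
out-fold (app M N) = refl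
out-fold (lam M)   = refl
out-fold (lam↓ M)  = refl
out-fold (lam↑ M)  = refl
out-fold (box↓ M)  = refl
out-fold (box↑ M)  = refl

label-out : ∀ M → label (out M) ≡ M []
label-out M with M []
... | var i = refl
... | app   = refl
... | lam   = refl
... | lam↓  = refl
... | lam↑  = refl
... | box↓  = refl
... | box↑  = refl

Layer-label : ∀ {ℓ} {R : Rel Preterm ℓ} {m n} → Layer R m n → label m ≡ label n
Layer-label var       = refl
Layer-label (app _ _) = refl
Layer-label (lam _)   = refl
Layer-label (lam↓ _)  = refl
Layer-label (lam↑ _)  = refl
Layer-label (box↓ _)  = refl
Layer-label (box↑ _)  = refl

bisimulation : ∀ {ℓ} (R : Rel Preterm ℓ) → (∀ {M N} → R M N → Layer R (out M) (out N)) →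
               ∀ {M N} → R M N → M ≈ N
bisimulation R step {M} {N} r [] =
  cong just (trans (sym (label-out M)) (trans (Layer-label (step r)) (label-out N)))
bisimulation R step {M} {N} r (d ∷ p) = go d (step r)
  where
  go : ∀ d {m n} → Layer R m n →
       (child d m >>= λ K → at K p) ≡ (child d n >>= λ K → at K p)
  go left  var       = refl
  go right var       = refl
  go left  (app r s) = bisimulation R step r p
  go right (app r s) = bisimulation R step s p
  go left  (lam r)   = bisimulation R step r p
  go right (lam r)   = refl
  go left  (lam↓ r)  = bisimulation R step r p
  go right (lam↓ r)  = refl
  go left  (lam↑ r)  = bisimulation R step r p
  go right (lam↑ r)  = refl
  go left  (box↓ r)  = bisimulation R step r p
  go right (box↓ r)  = refl
  go left  (box↑ r)  = bisimulation R step r p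
  go right (box↑ r)  = refl

≈ᴺ⇒≈ : ∀ {M N} → out M ≈ᴺ out N → M ≈ N
≈ᴺ⇒≈ = bisimulation (λ M N → out M ≈ᴺ out N) (Layer-map ≈⇒≈ᴺ)

≈-refl : ∀ {M} → M ≈ M
≈-refl p = refl

≈-sym : ∀ {M N} → M ≈ N → N ≈ M
≈-sym h p = sym (h p)

≈-trans : ∀ {M N L} → M ≈ N → N ≈ L → M ≈ L
≈-trans h k p = trans (h p) (k p)

≈ᴺ-refl : ∀ {m} → m ≈ᴺ m
≈ᴺ-refl {var _}   = var
≈ᴺ-refl {app M N} = app (≈-refl {M}) (≈-refl {N})
≈ᴺ-refl {lam M}   = lam (≈-refl {M})
≈ᴺ-refl {lam↓ M}  = lam↓ (≈-refl {M})
≈ᴺ-refl {lam↑ M}  = lam↑ (≈-refl {M})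
≈ᴺ-refl {box↓ M}  = box↓ (≈-refl {M})
≈ᴺ-refl {box↑ M}  = box↑ (≈-refl {M})

≈ᴺ-sym : ∀ {m n} → m ≈ᴺ n → n ≈ᴺ m
≈ᴺ-sym var       = var
≈ᴺ-sym (app h k) = app (λ p → sym (h p)) (λ p → sym (k p))
≈ᴺ-sym (lam h)   = lam (λ p → sym (h p))
≈ᴺ-sym (lam↓ h)  = lam↓ (λ p → sym (h p))
≈ᴺ-sym (lam↑ h)  = lam↑ (λ p → sym (h p))
≈ᴺ-sym (box↓ h)  = box↓ (λ p → sym (h p))
≈ᴺ-sym (box↑ h)  = box↑ (λ p → sym (h p))

≈ᴺ-trans : ∀ {m n l} → m ≈ᴺ n → n ≈ᴺ l → m ≈ᴺ l
≈ᴺ-trans var       var         = var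
≈ᴺ-trans (app h k) (app h′ k′) = app (λ p → trans (h p) (h′ p)) (λ p → trans (k p) (k′ p))
≈ᴺ-trans (lam h)   (lam h′)    = lam (λ p → trans (h p) (h′ p))
≈ᴺ-trans (lam↓ h)  (lam↓ h′)   = lam↓ (λ p → trans (h p) (h′ p))
≈ᴺ-trans (lam↑ h)  (lam↑ h′)   = lam↑ (λ p → trans (h p) (h′ p))
≈ᴺ-trans (box↓ h)  (box↓ h′)   = box↓ (λ p → trans (h p) (h′ p))
≈ᴺ-trans (box↑ h)  (box↑ h′)   = box↑ (λ p → trans (h p) (h′ p))

Substitution : Set
Substitution = ℕ → Preterm

variable
  ℓ ℓ′ : Level
  i j : ℕ
  ρ ρ′ ρ″ : ℕ → ℕ
  σ τ υ : Substitution
  m m′ n n′ l k : Node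
  M M′ N N′ L A A′ B B′ : Preterm

-- A traversal that reaches a variable returns an arbitrary tree, about which only `≈` is known; the
-- bisimulations below must be able to stop there.
data UpTo≈ (R : Rel Preterm ℓ) : Rel Preterm ℓ where
  rel : R M N → UpTo≈ R M N
  eq  : M ≈ N → UpTo≈ R M N

bisimulation-upTo≈ : (R : Rel Preterm ℓ) → (∀ {M N} → R M N → Layer (UpTo≈ R) (out M) (out N)) →
                     R M N → M ≈ N
bisimulation-upTo≈ R step r = bisimulation (UpTo≈ R) step′ (rel r)
  where
  step′ : UpTo≈ R M N → Layer (UpTo≈ R) (out M) (out N)
  step′ (rel r) = step r
  step′ (eq h)  = Layer-map eq (≈⇒≈ᴺ h)

-- Renaming, substitution and their composites: maps on trees that only act on the
-- variables, so that they are determined up to ≈ by their values there.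

module _ {P : Set} (act : P → Preterm → Preterm) (bind : P → P) (value : P → ℕ → Preterm) where

  traverse : P → Node → Node
  traverse e (var i)   = out (value e i)
  traverse e (app M N) = app (act e M) (act e N)
  traverse e (lam M)   = lam (act (bind e) M)
  traverse e (lam↓ M)  = lam↓ (act (bind e) M)
  traverse e (lam↑ M)  = lam↑ (act (bind e) M)
  traverse e (box↓ M)  = box↓ (act e M)
  traverse e (box↑ M)  = box↑ (act e M)

record Traversal : Set₁ where
  field
    Param   : Set
    act     : Param → Preterm → Preterm
    bind    : Param → Param
    value   : Param → ℕ → Preterm
    out-act : ∀ e M → out (act e M) ≡ traverse act bind value e (out M)

  actᴺ : Param → Node → Node
  actᴺ = traverse act bind value

open Traversal

idᵀ : Traversal
idᵀ .Param     = ⊤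
idᵀ .act _ M   = M
idᵀ .bind e    = e
idᵀ .value _ i = fold (var i)
idᵀ .out-act e M with out M
... | var _   = refl
... | app _ _ = refl
... | lam _   = refl
... | lam↓ _  = refl
... | lam↑ _  = refl
... | box↓ _  = refl
... | box↑ _  = refl

renameᵀ : Traversal
renameᵀ .Param     = ℕ → ℕ
renameᵀ .act       = rename
renameᵀ .bind      = ext
renameᵀ .value ρ i = fold (var (ρ i))
renameᵀ .out-act ρ M with out M
... | var _   = refl
... | app _ _ = refl
... | lam _   = refl
... | lam↓ _  = refl
... | lam↑ _  = refl
... | box↓ _  = refl
... | box↑ _  = refl

substᵀ : Traversal
substᵀ .Param = Substitution
substᵀ .act   = subst
substᵀ .bind  = exts
substᵀ .value = λ σ → σ
substᵀ .out-act σ M with out M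
... | var _   = refl
... | app _ _ = refl
... | lam _   = refl
... | lam↓ _  = refl
... | lam↑ _  = refl
... | box↓ _  = refl
... | box↑ _  = refl

_⊙_ : Traversal → Traversal → Traversal
T ⊙ U = record
  { Param   = Param T × Param U
  ; act     = λ (d , e) M → act T d (act U e M)
  ; bind    = λ (d , e) → bind T d , bind U e
  ; value   = λ (d , e) i → act T d (value U e i)
  ; out-act = λ (d , e) M →
      trans (out-act T d (act U e M)) (trans (cong (actᴺ T d) (out-act U e M)) (inner d e (out M)))
  }
  where
  inner : ∀ d e m → actᴺ T d (actᴺ U e m) ≡
          traverse (λ (d , e) M → act T d (act U e M)) (λ (d , e) → bind T d , bind U e)
            (λ (d , e) i → act T d (value U e i)) (d , e) m
  inner d e (var i)   = sym (out-act T d (value U e i))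
  inner d e (app _ _) = refl
  inner d e (lam _)   = refl
  inner d e (lam↓ _)  = refl
  inner d e (lam↑ _)  = refl
  inner d e (box↓ _)  = refl
  inner d e (box↑ _)  = refl

-- Away from variables both traversals copy the node, so agreement there and stability of P under
-- binders suffice. With composites for T and U, this one bisimulation yields all the congruence and
-- fusion laws.
module Agreement
  (T U : Traversal) (P : Param T → Param U → Set)
  (P-bind : ∀ {d e} → P d e → P (bind T d) (bind U e))
  (P-value : ∀ {d e} → P d e → ∀ i → value T d i ≈ value U e i)
  where

  data Agree : Rel Preterm 0ℓ where
    agree : ∀ {d e} → P d e → M ≈ N → Agree (act T d M) (act U e N)

  agreeᴺ : ∀ {d e} → P d e → m ≈ᴺ n → Layer (UpTo≈ Agree) (actᴺ T d m) (actᴺ U e n)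
  agreeᴺ p (var {i}) = Layer-map eq (≈⇒≈ᴺ (P-value p i))
  agreeᴺ p (app e f) = app (rel (agree p e)) (rel (agree p f))
  agreeᴺ p (lam e)   = lam (rel (agree (P-bind p) e))
  agreeᴺ p (lam↓ e)  = lam↓ (rel (agree (P-bind p) e))
  agreeᴺ p (lam↑ e)  = lam↑ (rel (agree (P-bind p) e))
  agreeᴺ p (box↓ e)  = box↓ (rel (agree p e))
  agreeᴺ p (box↑ e)  = box↑ (rel (agree p e))

  step : Agree M N → Layer (UpTo≈ Agree) (out M) (out N)
  step (agree {M = M} {N = N} {d} {e} p h) =
    subst₂ (Layer (UpTo≈ Agree)) (sym (out-act T d M)) (sym (out-act U e N)) (agreeᴺ p (≈⇒≈ᴺ h))

  act-≈ : ∀ {d e} → P d e → M ≈ N → act T d M ≈ act U e N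
  act-≈ p h = bisimulation-upTo≈ Agree step (agree p h)

≡⇒≈ : M ≡ N → M ≈ N
≡⇒≈ refl p = refl

rename-cong : (∀ i → ρ i ≡ ρ′ i) → M ≈ N → rename ρ M ≈ rename ρ′ N
rename-cong = act-≈
  where
  ext-cong : (∀ i → ρ i ≡ ρ′ i) → ∀ i → ext ρ i ≡ ext ρ′ i
  ext-cong h zero    = refl
  ext-cong h (suc i) = cong suc (h i)
  open Agreement renameᵀ renameᵀ (λ ρ ρ′ → ∀ i → ρ i ≡ ρ′ i)
    ext-cong (λ h i → ≡⇒≈ (cong (fold ∘ var) (h i)))

rename-rename : (∀ i → ρ′ (ρ i) ≡ ρ″ i) → ∀ M → rename ρ′ (rename ρ M) ≈ rename ρ″ M
rename-rename h M = act-≈ h (≈-refl {M})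
  where
  ext-fuse : (∀ i → ρ′ (ρ i) ≡ ρ″ i) → ∀ i → ext ρ′ (ext ρ i) ≡ ext ρ″ i
  ext-fuse h zero    = refl
  ext-fuse h (suc i) = cong suc (h i)
  open Agreement (renameᵀ ⊙ renameᵀ) renameᵀ (λ (ρ′ , ρ) ρ″ → ∀ i → ρ′ (ρ i) ≡ ρ″ i)
    ext-fuse (λ h i → ≡⇒≈ (cong (fold ∘ var) (h i)))

exts-cong : (∀ i → σ i ≈ τ i) → ∀ i → exts σ i ≈ exts τ i
exts-cong h zero    = ≈-refl {fold (var zero)}
exts-cong h (suc i) = rename-cong (λ _ → refl) (h i)

subst-cong : (∀ i → σ i ≈ τ i) → M ≈ N → subst σ M ≈ subst τ N
subst-cong = act-≈
  where open Agreement substᵀ substᵀ (λ σ τ → ∀ i → σ i ≈ τ i) exts-cong (λ h → h)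

subst-identity : (∀ i → σ i ≈ fold (var i)) → ∀ M → subst σ M ≈ M
subst-identity h M = act-≈ h (≈-refl {M})
  where
  exts-identity : (∀ i → σ i ≈ fold (var i)) → ∀ i → exts σ i ≈ fold (var i)
  exts-identity h zero    = ≈-refl {fold (var zero)}
  exts-identity h (suc i) = rename-cong (λ _ → refl) (h i)
  open Agreement substᵀ idᵀ (λ σ _ → ∀ i → σ i ≈ fold (var i)) exts-identity (λ h → h)

subst-rename : (∀ i → τ (ρ i) ≈ υ i) → ∀ M → subst τ (rename ρ M) ≈ subst υ M
subst-rename h M = act-≈ h (≈-refl {M})
  where
  exts-ext : (∀ i → τ (ρ i) ≈ υ i) → ∀ i → exts τ (ext ρ i) ≈ exts υ i
  exts-ext h zero    = ≈-refl {fold (var zero)}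
  exts-ext h (suc i) = rename-cong (λ _ → refl) (h i)
  open Agreement (substᵀ ⊙ renameᵀ) substᵀ (λ (τ , ρ) υ → ∀ i → τ (ρ i) ≈ υ i)
    exts-ext (λ h → h)

rename-subst : (∀ i → rename ρ (σ i) ≈ υ i) → ∀ M → rename ρ (subst σ M) ≈ subst υ M
rename-subst h M = act-≈ h (≈-refl {M})
  where
  ext-exts : (∀ i → rename ρ (σ i) ≈ υ i) → ∀ i → rename (ext ρ) (exts σ i) ≈ exts υ i
  ext-exts h zero    = ≈-refl {fold (var zero)}
  ext-exts {ρ} {σ} {υ} h (suc i) =
    ≈-trans {N = rename (suc ∘ ρ) (σ i)} (rename-rename (λ _ → refl) (σ i))
      (≈-trans (≈-sym (rename-rename (λ _ → refl) (σ i))) (rename-cong (λ _ → refl) (h i)))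
  open Agreement (renameᵀ ⊙ substᵀ) substᵀ (λ (ρ , σ) υ → ∀ i → rename ρ (σ i) ≈ υ i)
    (λ {d} {e} → ext-exts {proj₁ d} {proj₂ d} {e}) (λ h → h)

subst-subst : (∀ i → subst τ (σ i) ≈ υ i) → ∀ M → subst τ (subst σ M) ≈ subst υ M
subst-subst h M = act-≈ h (≈-refl {M})
  where
  exts-exts : (∀ i → subst τ (σ i) ≈ υ i) → ∀ i → subst (exts τ) (exts σ i) ≈ exts υ i
  exts-exts h zero    = ≈-refl {fold (var zero)}
  exts-exts {τ} {σ} {υ} h (suc i) =
    ≈-trans {N = subst (rename suc ∘ τ) (σ i)} (subst-rename (λ j → ≈-refl {rename suc (τ j)}) (σ i))
      (≈-trans (≈-sym (rename-subst (λ j → ≈-refl {rename suc (τ j)}) (σ i))) (rename-cong (λ _ → refl) (h i)))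
  open Agreement (substᵀ ⊙ substᵀ) substᵀ (λ (τ , σ) υ → ∀ i → subst τ (σ i) ≈ υ i)
    (λ {d} {e} → exts-exts {proj₁ d} {proj₂ d} {e}) (λ h → h)

subst-congᴺ : (∀ i → σ i ≈ τ i) → m ≈ᴺ n → out (substᴺ σ m) ≈ᴺ out (substᴺ τ n)
subst-congᴺ h (var {i}) = ≈⇒≈ᴺ (h i)
subst-congᴺ h (app e f) = app (subst-cong h e) (subst-cong h f)
subst-congᴺ h (lam e)   = lam (subst-cong (exts-cong h) e)
subst-congᴺ h (lam↓ e)  = lam↓ (subst-cong (exts-cong h) e)
subst-congᴺ h (lam↑ e)  = lam↑ (subst-cong (exts-cong h) e)
subst-congᴺ h (box↓ e)  = box↓ (subst-cong h e)
subst-congᴺ h (box↑ e)  = box↑ (subst-cong h e)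

rename-congᴺ : m ≈ᴺ n → out (renameᴺ ρ m) ≈ᴺ out (renameᴺ ρ n)
rename-congᴺ var       = var
rename-congᴺ (app e f) = app (rename-cong (λ _ → refl) e) (rename-cong (λ _ → refl) f)
rename-congᴺ (lam e)   = lam (rename-cong (λ _ → refl) e)
rename-congᴺ (lam↓ e)  = lam↓ (rename-cong (λ _ → refl) e)
rename-congᴺ (lam↑ e)  = lam↑ (rename-cong (λ _ → refl) e)
rename-congᴺ (box↓ e)  = box↓ (rename-cong (λ _ → refl) e)
rename-congᴺ (box↑ e)  = box↑ (rename-cong (λ _ → refl) e)

rename-[] : ∀ ρ A B → (rename (ext ρ) A [ rename ρ B ]) ≈ rename ρ (A [ B ])
rename-[] ρ A B =
  ≈-trans (subst-rename {υ = rename ρ ∘ single B} pointwise A)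
    (≈-sym (rename-subst (λ i → ≈-refl {rename ρ (single B i)}) A))
  where
  pointwise : ∀ i → single (rename ρ B) (ext ρ i) ≈ rename ρ (single B i)
  pointwise zero    = ≈-refl {rename ρ B}
  pointwise (suc i) = ≈-refl {fold (var (ρ i))}

subst-[] : ∀ σ A B → (subst (exts σ) A [ subst σ B ]) ≈ subst σ (A [ B ])
subst-[] σ A B =
  ≈-trans (subst-subst {υ = subst σ ∘ single B} pointwise A)
    (≈-sym (subst-subst (λ i → ≈-refl {subst σ (single B i)}) A))
  where
  pointwise : ∀ i → subst (single (subst σ B)) (exts σ i) ≈ subst σ (single B i)
  pointwise zero    = ≈-refl {subst σ B}
  pointwise (suc i) =
    ≈-trans {N = subst (fold ∘ var) (σ i)} (subst-rename (λ j → ≈-refl {fold (var j)}) (σ i))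
      (subst-identity (λ j → ≈-refl {fold (var j)}) (σ i))

-- Formation rules

-- Environments as functions.  In a derivation whose last environment is a list, the
-- rules keep all others finitely supported, so that nothing is lost.

Ctx : Set
Ctx = ℕ → Maybe Pattern

infixr 5 _∙_

_∙_ : Maybe Pattern → Ctx → Ctx
(π ∙ Γ) zero    = π
(π ∙ Γ) (suc i) = Γ i

variable
  π π₁ π₂ π′ : Maybe Pattern
  Γ Γ₁ Γ₂ Γ′ Δ Δ₁ Δ₂ : Ctx

data Usable : Maybe Pattern → Set where
  lin : Usable (just lin)
  #   : Usable (just #)
  †   : Usable (just †)

data Bang : Maybe Pattern → Set where
  # : Bang (just #)
  ↓ : Bang (just ↓)

data Der {ℓ : Level} (R : REL Ctx Preterm ℓ) (Γ : Ctx) : Node → Set ℓ where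
  vr : ∀ {i} → Usable (Γ i) → (∀ j → j ≢ i → Shared (Γ j)) → Der R Γ (var i)
  ap : ∀ {M N} (Γ₁ Γ₂ : Ctx) → (∀ j → Split (Γ₁ j) (Γ₂ j) (Γ j)) →
       Der R Γ₁ (out M) → Der R Γ₂ (out N) → Der R Γ (app M N)
  ll : ∀ {M} → Der R (just lin ∙ Γ) (out M) → Der R Γ (lam M)
  li : ∀ {M π} → Bang π → Der R (π ∙ Γ) (out M) → Der R Γ (lam↓ M)
  lc : ∀ {M} → Der R (just ↑ ∙ Γ) (out M) → Der R Γ (lam↑ M)
  mi : ∀ {M} (Δ : Ctx) → (∀ j → Under↓ (Δ j) (Γ j)) → Der R Δ (out M) → Der R Γ (box↓ M)
  mc : ∀ {M} (Δ : Ctx) → (∀ j → Under↑ (Δ j) (Γ j)) → R Δ M → Der R Γ (box↑ M)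

infix 4 _⊩_ _⊩ᴺ_

_⊩_ : Ctx → Preterm → Set₁
_⊩_ = ν λ R Γ M → Der R Γ (out M)

_⊩ᴺ_ : Ctx → Node → Set₁
_⊩ᴺ_ = Der _⊩_

Der-map : {R : REL Ctx Preterm ℓ} {S : REL Ctx Preterm ℓ′} → (∀ {Γ M} → R Γ M → S Γ M) →
          Der R Γ m → Der S Γ m
Der-map f (vr u s)         = vr u s
Der-map f (ap Γ₁ Γ₂ s d e) = ap Γ₁ Γ₂ s (Der-map f d) (Der-map f e)
Der-map f (ll d)           = ll (Der-map f d)
Der-map f (li b d)         = li b (Der-map f d)
Der-map f (lc d)           = lc (Der-map f d)
Der-map f (mi Δ u d)       = mi Δ u (Der-map f d)
Der-map f (mc Δ u r)       = mc Δ u (f r)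

Der-support : {S : REL Ctx Preterm (lsuc 0ℓ)} → Der S Γ m → Supported (λ R → Der R Γ m) S
Der-support (vr u s)         = support-⊥ (vr u s)
Der-support (ap Γ₁ Γ₂ s d e) =
  support-map (λ (d , e) → ap Γ₁ Γ₂ s d e) (support-× (Der-support d) (Der-support e))
Der-support (ll d)           = support-map ll (Der-support d)
Der-support (li b d)         = support-map (li b) (Der-support d)
Der-support (lc d)           = support-map lc (Der-support d)
Der-support (mi Δ u d)       = support-map (mi Δ u) (Der-support d)
Der-support (mc Δ u s)       = support-map (mc Δ u) (support-leaf s)

⊩-out : Γ ⊩ M → Γ ⊩ᴺ out M
⊩-out (R , step , r) = Der-map (λ r → R , (λ {_} → step) , r) (step r)

⊩-coinduction : (S : REL Ctx Preterm (lsuc 0ℓ)) → (∀ {Γ M} → S Γ M → Der S Γ (out M)) →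
                S Γ M → Γ ⊩ M
⊩-coinduction S step = ν-coinduction S (λ s → Der-support (step s))

⊩-in : Γ ⊩ᴺ out M → Γ ⊩ M
⊩-in = ⊩-coinduction (λ Γ M → Γ ⊩ᴺ out M) (Der-map ⊩-out)

-- Weakening

infix 4 _⊑_

-- An absent variable may only be added with a shared pattern, as rule (a) and the leaves tolerate
-- no other idle entry. `lin#` is sound because # also allows a single use outside boxes; no box
-- rule has a linear entry in its conclusion. It is needed when the contents of an inductive box get
-- copied.
data _⊑_ : Rel (Maybe Pattern) 0ℓ where
  same  : π ⊑ π
  none# : nothing ⊑ just #
  none↑ : nothing ⊑ just ↑
  none† : nothing ⊑ just †
  lin#  : just lin ⊑ just #

≡⇒⊑ : π ≡ π′ → π ⊑ π′
≡⇒⊑ refl = same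

Shared-⊑ : π ⊑ π′ → Shared π → Shared π′
Shared-⊑ same  s = s
Shared-⊑ none# s = #Θ
Shared-⊑ none↑ s = ↑Ξ
Shared-⊑ none† s = †Ψ

Usable-⊑ : π ⊑ π′ → Usable π → Usable π′
Usable-⊑ same u = u
Usable-⊑ lin# u = #

Split-⊑ : Split π₁ π₂ π → π ⊑ π′ → ∃[ π₁′ ] ∃[ π₂′ ] π₁ ⊑ π₁′ × π₂ ⊑ π₂′ × Split π₁′ π₂′ π′
Split-⊑ s             same  = _ , _ , same , same , s
Split-⊑ (shared none) none# = _ , _ , none# , none# , shared #Θ
Split-⊑ (shared none) none↑ = _ , _ , none↑ , none↑ , shared ↑Ξ
Split-⊑ (shared none) none† = _ , _ , none† , none† , shared †Ψ
Split-⊑ linΥ          lin#  = _ , _ , lin# , none# , shared #Θ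
Split-⊑ linΠ          lin#  = _ , _ , none# , lin# , shared #Θ

Under↓-⊑ : Under↓ π₁ π → π ⊑ π′ → ∃[ π₁′ ] π₁ ⊑ π₁′ × Under↓ π₁′ π′
Under↓-⊑ u    same  = _ , same , u
Under↓-⊑ none none# = _ , same , #Θ
Under↓-⊑ none none↑ = _ , none↑ , ↑Ψ
Under↓-⊑ none none† = _ , none† , †Φ

Under↑-⊑ : Under↑ π₁ π → π ⊑ π′ → ∃[ π₁′ ] π₁ ⊑ π₁′ × Under↑ π₁′ π′
Under↑-⊑ u    same  = _ , same , u
Under↑-⊑ none none# = _ , same , #Θ
Under↑-⊑ none none↑ = _ , none† , ↑Ξ
Under↑-⊑ none none† = _ , none† , †Ψ

∙-⊑ : (∀ j → Γ j ⊑ Γ′ j) → ∀ j → (π ∙ Γ) j ⊑ (π ∙ Γ′) j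
∙-⊑ h zero    = same
∙-⊑ h (suc j) = h j

data Weakened : Ctx → Preterm → Set₁ where
  weakened : Γ ⊩ M → (∀ j → Γ j ⊑ Γ′ j) → M ≈ N → Weakened Γ′ N

weakened-Der : Γ ⊩ᴺ m → (∀ j → Γ j ⊑ Γ′ j) → m ≈ᴺ n → Der Weakened Γ′ n
weakened-Der (vr {i} u s) h var = vr (Usable-⊑ (h i) u) λ j j≢i → Shared-⊑ (h j) (s j j≢i)
weakened-Der (ap Γ₁ Γ₂ s d e) h (app x y) =
  ap (proj₁ ∘ w) (proj₁ ∘ proj₂ ∘ w) (proj₂ ∘ proj₂ ∘ proj₂ ∘ proj₂ ∘ w)
    (weakened-Der d (proj₁ ∘ proj₂ ∘ proj₂ ∘ w) (≈⇒≈ᴺ x))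
    (weakened-Der e (proj₁ ∘ proj₂ ∘ proj₂ ∘ proj₂ ∘ w) (≈⇒≈ᴺ y))
  where w = λ j → Split-⊑ (s j) (h j)
weakened-Der (ll d)   h (lam x)  = ll (weakened-Der d (∙-⊑ h) (≈⇒≈ᴺ x))
weakened-Der (li b d) h (lam↓ x) = li b (weakened-Der d (∙-⊑ h) (≈⇒≈ᴺ x))
weakened-Der (lc d)   h (lam↑ x) = lc (weakened-Der d (∙-⊑ h) (≈⇒≈ᴺ x))
weakened-Der (mi Δ u d) h (box↓ x) =
  mi (proj₁ ∘ w) (proj₂ ∘ proj₂ ∘ w) (weakened-Der d (proj₁ ∘ proj₂ ∘ w) (≈⇒≈ᴺ x))
  where w = λ j → Under↓-⊑ (u j) (h j)
weakened-Der (mc Δ u t) h (box↑ x) =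
  mc (proj₁ ∘ w) (proj₂ ∘ proj₂ ∘ w) (weakened t (proj₁ ∘ proj₂ ∘ w) x)
  where w = λ j → Under↑-⊑ (u j) (h j)

-- Weakening and invariance under `≈` rebuild the same derivation, hence share one coinduction; with
-- `same` everywhere this is transport along `≈`.
weaken : Γ ⊩ M → (∀ j → Γ j ⊑ Γ′ j) → M ≈ N → Γ′ ⊩ N
weaken d h x = ⊩-coinduction Weakened (λ { (weakened d h x) → weakened-Der (⊩-out d) h (≈⇒≈ᴺ x) })
  (weakened d h x)

weakenᴺ : Γ ⊩ᴺ m → (∀ j → Γ j ⊑ Γ′ j) → m ≈ᴺ n → Γ′ ⊩ᴺ n
weakenᴺ d h x = Der-map (λ { (weakened d h x) → weaken d h x }) (weakened-Der d h x)

-- Shifting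

thin : ℕ → ℕ → ℕ
thin zero    = suc
thin (suc x) = ext (thin x)

data View (x : ℕ) : ℕ → Set where
  here  : View x x
  there : ∀ j → View x (thin x j)

view : ∀ x i → View x i
view zero    zero    = here
view zero    (suc i) = there i
view (suc x) zero    = there zero
view (suc x) (suc i) with view x i
... | here    = here
... | there j = there (suc j)

thin-injective : ∀ x {i j} → thin x i ≡ thin x j → i ≡ j
thin-injective zero    refl = refl
thin-injective (suc x) {zero}  {zero}  e = refl
thin-injective (suc x) {suc i} {suc j} e = cong suc (thin-injective x (suc-injective e))

thin-skips : ∀ x {i} → thin x i ≢ x
thin-skips (suc x) {suc i} e = thin-skips x (suc-injective e)

insert : ℕ → Maybe Pattern → Ctx → Ctx
insert zero    π Γ = π ∙ Γ
insert (suc x) π Γ = Γ zero ∙ insert x π (Γ ∘ suc)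

insert-here : ∀ x → insert x π Γ x ≡ π
insert-here zero    = refl
insert-here (suc x) = insert-here x

insert-there : ∀ x j → insert x π Γ (thin x j) ≡ Γ j
insert-there zero    j       = refl
insert-there (suc x) zero    = refl
insert-there (suc x) (suc j) = insert-there x j

insert-Split : ∀ x → (∀ j → Split (Γ₁ j) (Γ₂ j) (Γ j)) →
               ∀ j → Split (insert x nothing Γ₁ j) (insert x nothing Γ₂ j) (insert x nothing Γ j)
insert-Split zero    s zero    = shared none
insert-Split zero    s (suc j) = s j
insert-Split (suc x) s zero    = s zero
insert-Split (suc x) s (suc j) = insert-Split x (s ∘ suc) j

insert-Under↓ : ∀ x → (∀ j → Under↓ (Δ j) (Γ j)) →
                ∀ j → Under↓ (insert x nothing Δ j) (insert x nothing Γ j)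
insert-Under↓ zero    u zero    = none
insert-Under↓ zero    u (suc j) = u j
insert-Under↓ (suc x) u zero    = u zero
insert-Under↓ (suc x) u (suc j) = insert-Under↓ x (u ∘ suc) j

insert-Under↑ : ∀ x → (∀ j → Under↑ (Δ j) (Γ j)) →
                ∀ j → Under↑ (insert x nothing Δ j) (insert x nothing Γ j)
insert-Under↑ zero    u zero    = none
insert-Under↑ zero    u (suc j) = u j
insert-Under↑ (suc x) u zero    = u zero
insert-Under↑ (suc x) u (suc j) = insert-Under↑ x (u ∘ suc) j

-- Every binder passed raises x by one, so the invariant has to cover insertion at all depths.
data Renamed : Ctx → Preterm → Set₁ where
  renamed : ∀ x → Γ ⊩ M → Renamed (insert x nothing Γ) (rename (thin x) M)

renamed-Der : ∀ x → Γ ⊩ᴺ m → Der Renamed (insert x nothing Γ) (out (renameᴺ (thin x) m))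
renamed-Der {Γ} x (vr {i} u s) = vr usable others
  where
  usable : Usable (insert x nothing Γ (thin x i))
  usable rewrite insert-there {nothing} {Γ} x i = u
  others : ∀ j → j ≢ thin x i → Shared (insert x nothing Γ j)
  others j j≢ with view x j
  ... | here     rewrite insert-here {nothing} {Γ} x = none
  ... | there j′ rewrite insert-there {nothing} {Γ} x j′ = s j′ λ { refl → j≢ refl }
renamed-Der x (ap Γ₁ Γ₂ s d e) =
  ap (insert x nothing Γ₁) (insert x nothing Γ₂) (insert-Split x s) (renamed-Der x d) (renamed-Der x e)
renamed-Der x (ll d)     = ll (renamed-Der (suc x) d)
renamed-Der x (li b d)   = li b (renamed-Der (suc x) d)
renamed-Der x (lc d)     = lc (renamed-Der (suc x) d)
renamed-Der x (mi Δ u d) = mi (insert x nothing Δ) (insert-Under↓ x u) (renamed-Der x d)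
renamed-Der x (mc Δ u t) = mc (insert x nothing Δ) (insert-Under↑ x u) (renamed x t)

⊩-shift : Γ ⊩ M → nothing ∙ Γ ⊩ rename suc M
⊩-shift d = ⊩-coinduction Renamed (λ { (renamed x d) → renamed-Der x (⊩-out d) }) (renamed zero d)

-- Substitution lemma

-- The part of an environment that rule (a) passes to both premises.

common : Maybe Pattern → Maybe Pattern
common nothing    = nothing
common (just lin) = nothing
common (just ↓)   = nothing
common (just ↑)   = just ↑
common (just #)   = just #
common (just †)   = just †

common-Shared : ∀ π → Shared (common π)
common-Shared nothing    = none
common-Shared (just lin) = none
common-Shared (just ↓)   = none
common-Shared (just ↑)   = ↑Ξ
common-Shared (just #)   = #Θ
common-Shared (just †)   = †Ψ

Split-commonʳ : ∀ π → Split π (common π) π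
Split-commonʳ nothing    = shared none
Split-commonʳ (just lin) = linΥ
Split-commonʳ (just ↓)   = ↓Υ
Split-commonʳ (just ↑)   = shared ↑Ξ
Split-commonʳ (just #)   = shared #Θ
Split-commonʳ (just †)   = shared †Ψ

Split-sym : Split π₁ π₂ π → Split π₂ π₁ π
Split-sym linΥ       = linΠ
Split-sym ↓Υ         = ↓Π
Split-sym linΠ       = linΥ
Split-sym ↓Π         = ↓Υ
Split-sym (shared s) = shared s

nothing⊑ : Shared π → nothing ⊑ π
nothing⊑ none = same
nothing⊑ #Θ   = none#
nothing⊑ ↑Ξ   = none↑
nothing⊑ †Ψ   = none†

Split-sharedˡ : Shared π₁ → Split π₁ π₂ π → π₂ ≡ π
Split-sharedˡ s linΠ       = refl
Split-sharedˡ s ↓Π         = refl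
Split-sharedˡ s (shared _) = refl

-- `Split` is the graph of a partial commutative operation on entries, idempotent on the shared
-- ones, and this is its medial law. It distributes the environment of an argument over the two
-- premises of rule (a).
Split-interchange : ∀ {a b c d₁ d₂ d e} → Split a b c → Split d₁ d₂ d → Split c d e →
                    ∃[ c₁ ] ∃[ c₂ ] Split a d₁ c₁ × Split b d₂ c₂ × Split c₁ c₂ e
Split-interchange linΥ (shared none) linΥ = _ , _ , linΥ , shared none , linΥ
Split-interchange ↓Υ   (shared none) ↓Υ   = _ , _ , ↓Υ , shared none , ↓Υ
Split-interchange linΠ (shared none) linΥ = _ , _ , shared none , linΥ , linΠ
Split-interchange ↓Π   (shared none) ↓Υ   = _ , _ , shared none , ↓Υ , ↓Π
Split-interchange (shared none) linΥ linΠ = _ , _ , linΠ , shared none , linΥ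
Split-interchange (shared none) linΠ linΠ = _ , _ , shared none , linΠ , linΠ
Split-interchange (shared none) ↓Υ ↓Π = _ , _ , ↓Π , shared none , ↓Υ
Split-interchange (shared none) ↓Π ↓Π = _ , _ , shared none , ↓Π , ↓Π
Split-interchange (shared s) (shared _) (shared _) = _ , _ , shared s , shared s , shared s

Split-Under↓ : ∀ {a b c d e} → Under↓ a c → Under↓ b d → Split c d e →
               ∃[ f ] Split a b f × Under↓ f e
Split-Under↓ ↓Ξ   none ↓Υ         = _ , linΥ , ↓Ξ
Split-Under↓ none ↓Ξ   ↓Π         = _ , linΠ , ↓Ξ
Split-Under↓ none none (shared s) = _ , shared none , none
Split-Under↓ #Θ   #Θ   (shared s) = _ , shared none , #Θ
Split-Under↓ ↑Ψ   ↑Ψ   (shared s) = _ , shared ↑Ξ , ↑Ψ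
Split-Under↓ †Φ   †Φ   (shared s) = _ , shared †Ψ , †Φ

Split-Under↑ : ∀ {a b c d e} → Under↑ a c → Under↑ b d → Split c d e →
               ∃[ f ] Split a b f × Under↑ f e
Split-Under↑ none none (shared s) = _ , shared none , none
Split-Under↑ #Θ   #Θ   (shared s) = _ , shared none , #Θ
Split-Under↑ ↑Ξ   ↑Ξ   (shared s) = _ , shared †Ψ , ↑Ξ
Split-Under↑ †Ψ   †Ψ   (shared s) = _ , shared †Ψ , †Ψ

-- Entries of †-environments typing the contents of a coinductive box, against those
-- of an environment in which a variable †x, resp. ↑x, stands for these contents.

data Below† : Maybe Pattern → Maybe Pattern → Set where
  idle : Shared π → Below† nothing π
  †Ψ   : Below† (just †) (just †)

data Below↑ : Maybe Pattern → Maybe Pattern → Set where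
  idle : Shared π → Below↑ nothing π
  ↑Ξ   : Below↑ (just †) (just ↑)
  †Ψ   : Below↑ (just †) (just †)

-- B may be substituted for a variable occurring in the pattern π, Γ being the
-- environment in which the occurrence of that variable is to be replaced.

data Arg : Maybe Pattern → Ctx → Preterm → Set₁ where
  none : (∀ j → Shared (Γ j)) → Arg nothing Γ B
  lin  : Γ ⊩ B → Arg (just lin) Γ B
  #    : (∀ j → Shared (Γ j)) → Γ ⊩ B → Arg (just #) Γ B
  ↓    : (∀ j → Under↓ (Δ j) (Γ j)) → Δ ⊩ B → Arg (just ↓) Γ B
  ↑    : (∀ j → Below↑ (Δ j) (Γ j)) → Δ ⊩ B → Arg (just ↑) Γ B
  †    : (∀ j → Below† (Δ j) (Γ j)) → Δ ⊩ B → Arg (just †) Γ B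

Below†-Shared : Below† π₁ π → Shared π
Below†-Shared (idle s) = s
Below†-Shared †Ψ       = †Ψ

Below↑-Shared : Below↑ π₁ π → Shared π
Below↑-Shared (idle s) = s
Below↑-Shared ↑Ξ       = ↑Ξ
Below↑-Shared †Ψ       = †Ψ

Below†-⊑ : Below† π₁ π → π₁ ⊑ π
Below†-⊑ (idle s) = nothing⊑ s
Below†-⊑ †Ψ       = same

Arg-Shared : Shared π → Arg π Γ B → ∀ j → Shared (Γ j)
Arg-Shared s (none h) j = h j
Arg-Shared s (# h _)  j = h j
Arg-Shared s (↑ b _)  j = Below↑-Shared (b j)
Arg-Shared s († b _)  j = Below†-Shared (b j)

Arg-use : Usable π → Arg π Γ B → Γ ⊩ B
Arg-use u (lin d) = d
Arg-use u (# _ d) = d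
Arg-use {B = B} u († b d) = weaken d (Below†-⊑ ∘ b) (≈-refl {B})

-- A variable lin or ↓ goes to one premise and takes the whole environment of its argument along,
-- leaving the `common` part to the other. A shared variable goes to both, and the environment of
-- its argument is then shared too.
Arg-split : Split π₁ π₂ π → Arg π Γ B →
            ∃[ Γ₁ ] ∃[ Γ₂ ] (∀ j → Split (Γ₁ j) (Γ₂ j) (Γ j)) × Arg π₁ Γ₁ B × Arg π₂ Γ₂ B
Arg-split {Γ = Γ} linΥ a =
  _ , _ , Split-commonʳ ∘ Γ , a , none (common-Shared ∘ Γ)
Arg-split {Γ = Γ} ↓Υ a = _ , _ , Split-commonʳ ∘ Γ , a , none (common-Shared ∘ Γ)
Arg-split {Γ = Γ} linΠ a = _ , _ , Split-sym ∘ Split-commonʳ ∘ Γ , none (common-Shared ∘ Γ) , a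
Arg-split {Γ = Γ} ↓Π a = _ , _ , Split-sym ∘ Split-commonʳ ∘ Γ , none (common-Shared ∘ Γ) , a
Arg-split (shared s) a = _ , _ , shared ∘ Arg-Shared s a , a , a

below↓ : Shared π → ∃[ π₁ ] Shared π₁ × Under↓ π₁ π
below↓ none = _ , none , none
below↓ #Θ   = _ , none , #Θ
below↓ ↑Ξ   = _ , ↑Ξ , ↑Ψ
below↓ †Ψ   = _ , †Ψ , †Φ

below↑ : Shared π → ∃[ π₁ ] Shared π₁ × Under↑ π₁ π
below↑ none = _ , none , none
below↑ #Θ   = _ , none , #Θ
below↑ ↑Ξ   = _ , †Ψ , ↑Ξ
below↑ †Ψ   = _ , †Ψ , †Ψ

Below†-Under↓ : Below† π₁ π → ∃[ π′ ] Below† π₁ π′ × Under↓ π′ π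
Below†-Under↓ (idle s) = let π , s′ , u = below↓ s in π , idle s′ , u
Below†-Under↓ †Ψ       = _ , †Ψ , †Φ

Below↑-Under↓ : Below↑ π₁ π → ∃[ π′ ] Below↑ π₁ π′ × Under↓ π′ π
Below↑-Under↓ (idle s) = let π , s′ , u = below↓ s in π , idle s′ , u
Below↑-Under↓ ↑Ξ       = _ , ↑Ξ , ↑Ψ
Below↑-Under↓ †Ψ       = _ , †Ψ , †Φ

Below†-Under↑ : Below† π₁ π → ∃[ π′ ] Below† π₁ π′ × Under↑ π′ π
Below†-Under↑ (idle s) = let π , s′ , u = below↑ s in π , idle s′ , u
Below†-Under↑ †Ψ       = _ , †Ψ , †Ψ

Below↑-Under↑ : Below↑ π₁ π → ∃[ π′ ] Below† π₁ π′ × Under↑ π′ π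
Below↑-Under↑ (idle s) = let π , s′ , u = below↑ s in π , idle s′ , u
Below↑-Under↑ ↑Ξ       = _ , †Ψ , ↑Ξ
Below↑-Under↑ †Ψ       = _ , †Ψ , †Ψ

-- The argument follows its variable into the box. The variable #x disappears there and its argument
-- is dropped; ↓x becomes x, which unpacks the environment of the argument; for ↑x and †x the
-- derivation of the argument stays as it is and only the surrounding environment is adjusted.
Arg-Under↓ : Under↓ π₁ π → Arg π Γ B → ∃[ Δ ] (∀ j → Under↓ (Δ j) (Γ j)) × Arg π₁ Δ B
Arg-Under↓ none (none h) = let w = λ j → below↓ (h j) in _ , proj₂ ∘ proj₂ ∘ w , none (proj₁ ∘ proj₂ ∘ w)
Arg-Under↓ #Θ   (# h _)  = let w = λ j → below↓ (h j) in _ , proj₂ ∘ proj₂ ∘ w , none (proj₁ ∘ proj₂ ∘ w)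
Arg-Under↓ ↓Ξ   (↓ u d)  = _ , u , lin d
Arg-Under↓ ↑Ψ   (↑ b d)  = let w = λ j → Below↑-Under↓ (b j) in _ , proj₂ ∘ proj₂ ∘ w , ↑ (proj₁ ∘ proj₂ ∘ w) d
Arg-Under↓ †Φ   († b d)  = let w = λ j → Below†-Under↓ (b j) in _ , proj₂ ∘ proj₂ ∘ w , † (proj₁ ∘ proj₂ ∘ w) d

Arg-Under↑ : Under↑ π₁ π → Arg π Γ B → ∃[ Δ ] (∀ j → Under↑ (Δ j) (Γ j)) × Arg π₁ Δ B
Arg-Under↑ none (none h) = let w = λ j → below↑ (h j) in _ , proj₂ ∘ proj₂ ∘ w , none (proj₁ ∘ proj₂ ∘ w)
Arg-Under↑ #Θ   (# h _)  = let w = λ j → below↑ (h j) in _ , proj₂ ∘ proj₂ ∘ w , none (proj₁ ∘ proj₂ ∘ w)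
Arg-Under↑ ↑Ξ   (↑ b d)  = let w = λ j → Below↑-Under↑ (b j) in _ , proj₂ ∘ proj₂ ∘ w , † (proj₁ ∘ proj₂ ∘ w) d
Arg-Under↑ †Ψ   († b d)  = let w = λ j → Below†-Under↑ (b j) in _ , proj₂ ∘ proj₂ ∘ w , † (proj₁ ∘ proj₂ ∘ w) d

infixr 5 _▸_

_▸_ : {P : ℕ → Set} → P zero → (∀ j → P (suc j)) → ∀ j → P j
(p ▸ h) zero    = p
(p ▸ h) (suc j) = h j

⊩-shift-⊑ : Shared π → Γ ⊩ B → π ∙ Γ ⊩ rename suc B
⊩-shift-⊑ {B = B} s d =
  weaken (⊩-shift d) (nothing⊑ s ▸ λ _ → same) (≈-refl {rename suc B})

Arg-shift : Shared π′ → Arg π Γ B → Arg π (π′ ∙ Γ) (rename suc B)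
Arg-shift s (none h) = none (s ▸ h)
Arg-shift s (lin d)  = lin (⊩-shift-⊑ s d)
Arg-shift s (# h d)  = # (s ▸ h) (⊩-shift-⊑ s d)
Arg-shift s (↓ u d)  =
  let _ , s′ , u′ = below↓ s in ↓ (u′ ▸ u) (⊩-shift-⊑ s′ d)
Arg-shift s (↑ b d)  = ↑ (idle s ▸ b) (⊩-shift d)
Arg-shift s († b d)  = † (idle s ▸ b) (⊩-shift d)

-- The conditions on σ are stated up to `≈` and at an arbitrary x, a form that `exts` preserves;
-- `single` itself is lost under the first binder.
record Fits (x : ℕ) (Γ₁ : Ctx) (Γ : Ctx) (σ : Substitution) : Set₁ where
  constructor fits
  field
    {argument} : Preterm
    {context}  : Ctx
    split : ∀ j → Split (Γ₁ (thin x j)) (context j) (Γ j)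
    arg   : Arg (Γ₁ x) context argument
    at-x  : σ x ≈ argument
    off-x : ∀ j → σ (thin x j) ≈ fold (var j)

-- `typed` covers the place where x is replaced: the derivation continues with that of the argument,
-- which is no longer an instance of the substitution.
data Substituted : Ctx → Preterm → Set₁ where
  typed       : Γ ⊩ M → Substituted Γ M
  substituted : ∀ x → Γ₁ ⊩ M → Fits x Γ₁ Γ σ → Substituted Γ (subst σ M)

Fits-∙ : ∀ {x} π → Fits x Γ₁ Γ σ → Fits (suc x) (π ∙ Γ₁) (π ∙ Γ) (exts σ)
Fits-∙ {x = x} π (fits {B} {Γ₂} s a h k) = fits {context = common π ∙ Γ₂}
  (Split-commonʳ π ▸ s) (Arg-shift (common-Shared π) a)
  (rename-cong (λ _ → refl) h)
  (≈-refl {fold (var zero)} ▸ λ j → rename-cong (λ _ → refl) (k j))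

Fits-usable : ∀ {x i} → Fits x Γ₁ Γ σ → Usable (Γ₁ i) → (∀ j → j ≢ i → Shared (Γ₁ j)) → Γ ⊩ σ i
Fits-usable {Γ₁} {Γ} {x = x} {i} (fits s a h k) u t with view x i
... | here = weaken (Arg-use u a)
      (λ j → ≡⇒⊑ (Split-sharedˡ (t (thin x j) (thin-skips x)) (s j))) (≈-sym h)
... | there i′ = ⊩-in (weakenᴺ {m = var i′} (vr usable others) (λ _ → same) (≈ᴺ-sym (≈⇒≈ᴺ (k i′))))
  where
  -- As x is not the variable used at this leaf, its pattern is shared; then so is the environment
  -- of the argument, and joining it changes no entry.
  kept : ∀ j → Γ₁ (thin x j) ≡ Γ j
  kept j = Split-sharedˡ (Arg-Shared (t x (thin-skips x ∘ sym)) a j) (Split-sym (s j))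
  usable : Usable (Γ i′)
  usable rewrite sym (kept i′) = u
  others : ∀ j → j ≢ i′ → Shared (Γ j)
  others j j≢ rewrite sym (kept j) = t (thin x j) (j≢ ∘ thin-injective x)

substituted-Der : ∀ x → Γ₁ ⊩ᴺ m → Fits x Γ₁ Γ σ → Der Substituted Γ (out (substᴺ σ m))
substituted-Der x (vr u t) f = Der-map typed (⊩-out (Fits-usable f u t))
substituted-Der x (ap Γ₁ Γ₂ s d e) (fits t a h k) =
  let _ , _ , sa , a₁ , a₂ = Arg-split (s x) a
      w = λ j → Split-interchange (s (thin x j)) (sa j) (t j)
  in ap (proj₁ ∘ w) (proj₁ ∘ proj₂ ∘ w) (proj₂ ∘ proj₂ ∘ proj₂ ∘ proj₂ ∘ w)
       (substituted-Der x d (fits (proj₁ ∘ proj₂ ∘ proj₂ ∘ w) a₁ h k))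
       (substituted-Der x e (fits (proj₁ ∘ proj₂ ∘ proj₂ ∘ proj₂ ∘ w) a₂ h k))
substituted-Der x (ll d)   f = ll (substituted-Der (suc x) d (Fits-∙ _ f))
substituted-Der x (li b d) f = li b (substituted-Der (suc x) d (Fits-∙ _ f))
substituted-Der x (lc d)   f = lc (substituted-Der (suc x) d (Fits-∙ _ f))
substituted-Der x (mi Δ u d) (fits t a h k) =
  let _ , ua , a′ = Arg-Under↓ (u x) a
      w = λ j → Split-Under↓ (u (thin x j)) (ua j) (t j)
  in mi (proj₁ ∘ w) (proj₂ ∘ proj₂ ∘ w) (substituted-Der x d (fits (proj₁ ∘ proj₂ ∘ w) a′ h k))
substituted-Der x (mc Δ u d) (fits t a h k) =
  let _ , ua , a′ = Arg-Under↑ (u x) a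
      w = λ j → Split-Under↑ (u (thin x j)) (ua j) (t j)
  in mc (proj₁ ∘ w) (proj₂ ∘ proj₂ ∘ w) (substituted x d (fits (proj₁ ∘ proj₂ ∘ w) a′ h k))

⊩-[] : π ∙ Γ₁ ⊩ A → (∀ j → Split (Γ₁ j) (Γ₂ j) (Γ j)) → Arg π Γ₂ B → Γ ⊩ A [ B ]
⊩-[] {B = B} d s a = ⊩-coinduction Substituted step
  (substituted zero d (fits s a (≈-refl {B}) λ j → ≈-refl {fold (var j)}))
  where
  step : Substituted Γ M → Der Substituted Γ (out M)
  step (typed d)           = Der-map typed (⊩-out d)
  step (substituted x d f) = substituted-Der x (⊩-out d) f

-- Subject reduction for finite reductions

-- Contracting a redex (λ↓x.M)(↓N) with #x in M turns the patterns ↓y of ↓N into #y: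
-- this is all that reduction does to an environment.

infix 4 _⊳_ _⊳ᴱ_

data _⊳_ : Rel (Maybe Pattern) 0ℓ where
  same : π ⊳ π
  ↓#   : just ↓ ⊳ just #

_⊳ᴱ_ : Rel Ctx 0ℓ
Γ ⊳ᴱ Δ = ∀ j → Γ j ⊳ Δ j

⊳-trans : π ⊳ π₁ → π₁ ⊳ π₂ → π ⊳ π₂
⊳-trans same g    = g
⊳-trans ↓#   same = ↓#

Split-⊳ : Split π₁ π₂ π → π₁ ⊳ π′ → ∃[ ϕ₂ ] ∃[ ϕ ] π₂ ⊑ ϕ₂ × Split π′ ϕ₂ ϕ × π ⊳ ϕ
Split-⊳ s  same = _ , _ , same , s , same
Split-⊳ ↓Υ ↓#   = _ , _ , none# , shared #Θ , ↓#

Split-# : ∀ {ϕ} → Split π₁ π₂ π → Under↓ ϕ π₂ →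
          ∃[ π₁′ ] ∃[ π₂′ ] ∃[ π′ ] π₁ ⊑ π₁′ × Shared π₂′ × ϕ ⊑ π₂′ × Split π₁′ π₂′ π′ × π ⊳ π′
Split-# linΥ none       = _ , _ , _ , same , none , same , linΥ , same
Split-# ↓Υ   none       = _ , _ , _ , same , none , same , ↓Υ , same
Split-# ↓Π   ↓Ξ         = _ , _ , _ , none# , #Θ , lin# , shared #Θ , ↓#
Split-# (shared s) none = _ , _ , _ , same , s , same , shared s , same
Split-# (shared s) #Θ   = _ , _ , _ , same , s , none# , shared s , same
Split-# (shared s) ↑Ψ   = _ , _ , _ , same , s , same , shared s , same
Split-# (shared s) †Φ   = _ , _ , _ , same , s , same , shared s , same

Under↑⇒Below↑ : Under↑ π₁ π → Below↑ π₁ π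
Under↑⇒Below↑ none = idle none
Under↑⇒Below↑ #Θ   = idle #Θ
Under↑⇒Below↑ ↑Ξ   = ↑Ξ
Under↑⇒Below↑ †Ψ   = †Ψ

⊩-↦ : L ↦ N → Γ ⊩ᴺ out L → ∃[ Δ ] Γ ⊳ᴱ Δ × Δ ⊩ N
⊩-↦ β  (ap Γ₁ Γ₂ s (ll d) e) = _ , (λ _ → same) , ⊩-[] (⊩-in d) s (lin (⊩-in e))
⊩-↦ (β↓ {M} {N}) (ap Γ₁ Γ₂ s (li # d) (mi Δ u e)) =
  let w = λ j → Split-# (s j) (u j) in
  _ , proj₂ ∘ proj₂ ∘ proj₂ ∘ proj₂ ∘ proj₂ ∘ proj₂ ∘ proj₂ ∘ w ,
  ⊩-[] (weaken (⊩-in d) (same ▸ proj₁ ∘ proj₂ ∘ proj₂ ∘ proj₂ ∘ w) (≈-refl {M}))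
    (proj₁ ∘ proj₂ ∘ proj₂ ∘ proj₂ ∘ proj₂ ∘ proj₂ ∘ proj₂ ∘ w)
    (# (proj₁ ∘ proj₂ ∘ proj₂ ∘ proj₂ ∘ proj₂ ∘ w)
       (weaken (⊩-in e) (proj₁ ∘ proj₂ ∘ proj₂ ∘ proj₂ ∘ proj₂ ∘ proj₂ ∘ w) (≈-refl {N})))
⊩-↦ β↓ (ap Γ₁ Γ₂ s (li ↓ d) (mi Δ u e)) =
  _ , (λ _ → same) , ⊩-[] (⊩-in d) s (↓ u (⊩-in e))
⊩-↦ β↑ (ap Γ₁ Γ₂ s (lc d) (mc Δ u e)) =
  _ , (λ _ → same) , ⊩-[] (⊩-in d) s (↑ (Under↑⇒Below↑ ∘ u) e)

lin-⊳ : just lin ⊳ π → π ≡ just lin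
lin-⊳ same = refl

↑-⊳ : just ↑ ⊳ π → π ≡ just ↑
↑-⊳ same = refl

Bang-⊳ : π ⊳ π′ → Bang π → Bang π′
Bang-⊳ same b = b
Bang-⊳ ↓#   b = #

-- No entry in the premise of a box rule is ↓, so ⊳ is the identity there: steps inside a box leave
-- the environment of the box unchanged.
Under↓-⊳ : Under↓ π₁ π → π₁ ⊳ π₂ → π₂ ⊑ π₁
Under↓-⊳ u same = same

Under↑-⊳ : Under↑ π₁ π → π₁ ⊳ π₂ → π₂ ⊑ π₁
Under↑-⊳ u same = same

⊩ᴺ-uncons : Γ zero ≡ π → Γ ⊩ᴺ m → π ∙ (Γ ∘ suc) ⊩ᴺ m
⊩ᴺ-uncons e d = weakenᴺ d (≡⇒⊑ e ▸ λ _ → same) ≈ᴺ-refl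

⊩-plug : ∀ C → L ↦ N → Γ ⊩ᴺ out (plug C L) → ∃[ Δ ] Γ ⊳ᴱ Δ × Δ ⊩ᴺ out (plug C N)
⊩-plug □ r d = let Δ , g , d′ = ⊩-↦ r d in Δ , g , ⊩-out d′
⊩-plug (appˡ C K) r (ap Γ₁ Γ₂ s d e) =
  let Δ₁ , g , d′ = ⊩-plug C r d
      w = λ j → Split-⊳ (s j) (g j)
  in _ , proj₂ ∘ proj₂ ∘ proj₂ ∘ proj₂ ∘ w ,
     ap Δ₁ (proj₁ ∘ w) (proj₁ ∘ proj₂ ∘ proj₂ ∘ proj₂ ∘ w) d′ (weakenᴺ e (proj₁ ∘ proj₂ ∘ proj₂ ∘ w) ≈ᴺ-refl)
⊩-plug (appʳ K C) r (ap Γ₁ Γ₂ s d e) =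
  let Δ₂ , g , e′ = ⊩-plug C r e
      w = λ j → Split-⊳ (Split-sym (s j)) (g j)
  in _ , proj₂ ∘ proj₂ ∘ proj₂ ∘ proj₂ ∘ w ,
     ap (proj₁ ∘ w) Δ₂ (Split-sym ∘ proj₁ ∘ proj₂ ∘ proj₂ ∘ proj₂ ∘ w) (weakenᴺ d (proj₁ ∘ proj₂ ∘ proj₂ ∘ w) ≈ᴺ-refl) e′
⊩-plug (lam C) r (ll d) =
  let Δ , g , d′ = ⊩-plug C r d in Δ ∘ suc , g ∘ suc , ll (⊩ᴺ-uncons (lin-⊳ (g zero)) d′)
⊩-plug (lam↓ C) r (li b d) =
  let Δ , g , d′ = ⊩-plug C r d in Δ ∘ suc , g ∘ suc , li (Bang-⊳ (g zero) b) (⊩ᴺ-uncons refl d′)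
⊩-plug (lam↑ C) r (lc d) =
  let Δ , g , d′ = ⊩-plug C r d in Δ ∘ suc , g ∘ suc , lc (⊩ᴺ-uncons (↑-⊳ (g zero)) d′)
⊩-plug (box↓ C) r (mi Δ u d) =
  let _ , g , d′ = ⊩-plug C r d in
  _ , (λ _ → same) , mi Δ u (weakenᴺ d′ (λ j → Under↓-⊳ (u j) (g j)) ≈ᴺ-refl)
⊩-plug (box↑ C) r (mc Δ u t) =
  let _ , g , d′ = ⊩-plug C r (⊩-out t) in
  _ , (λ _ → same) , mc Δ u (⊩-in (weakenᴺ d′ (λ j → Under↑-⊳ (u j) (g j)) ≈ᴺ-refl))

⊩-⟶ : Γ ⊩ M → M ⟶ N → ∃[ Δ ] Γ ⊳ᴱ Δ × Δ ⊩ N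
⊩-⟶ d (C , L , P , e , f , r) =
  let Δ , g , d′ = ⊩-plug C r (weakenᴺ (⊩-out d) (λ _ → same) (≈⇒≈ᴺ e)) in
  Δ , g , weaken (⊩-in d′) (λ _ → same) (≈-sym f)

⊩-⟶* : Γ ⊩ M → M ⟶* N → ∃[ Δ ] Γ ⊳ᴱ Δ × Δ ⊩ N
⊩-⟶* d (K , ε , e) = _ , (λ _ → same) , weaken d (λ _ → same) e
⊩-⟶* d (K , s ◅ ss , e) =
  let _ , g , d′ = ⊩-⟶ d s
      Δ , h , d″ = ⊩-⟶* d′ (K , ss , e)
  in Δ , (λ j → ⊳-trans (g j) (h j)) , d″

-- Parallel reduction outside the coinductive boxes

data Kind : Set where
  lin ↓ ↑ : Kind

variable
  κ : Kind
  b b₁ b₂ b′ : Node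

-- An application of m to n is a redex with body A and argument b.

data Redex : Kind → Node → Node → Preterm → Node → Set where
  lin : Redex lin (lam A) n A n
  ↓   : Redex ↓ (lam↓ A) (box↓ B) A (out B)
  ↑   : Redex ↑ (lam↑ A) (box↑ B) A (out B)

infix 4 _⇛_ _⇛[_]_

mutual
  data _⇛_ : Rel Node 0ℓ where
    var  : var i ⇛ var i
    app  : out M ⇛ out M′ → out N ⇛ out N′ → app M N ⇛ app M′ N′
    lam  : out M ⇛ out M′ → lam M ⇛ lam M′
    lam↓ : out M ⇛ out M′ → lam↓ M ⇛ lam↓ M′
    lam↑ : out M ⇛ out M′ → lam↑ M ⇛ lam↑ M′
    box↓ : out M ⇛ out M′ → box↓ M ⇛ box↓ M′
    box↑ : M ≈ M′ → box↑ M ⇛ box↑ M′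
    β    : Redex κ (out M) (out N) A b → out A ⇛ out A′ → b ⇛[ κ ] out B′ →
           out (A′ [ B′ ]) ≈ᴺ k → app M N ⇛ k

  -- The argument of a λ↑ redex is the contents of a coinductive box, which ⇛ must not touch; hence
  -- only `≈` in that case.
  data _⇛[_]_ : Node → Kind → Node → Set where
    lin : b ⇛ b′ → b ⇛[ lin ] b′
    ↓   : b ⇛ b′ → b ⇛[ ↓ ] b′
    ↑   : b ≈ᴺ b′ → b ⇛[ ↑ ] b′

⟶-≈ˡ : M ≈ N → N ⟶ L → M ⟶ L
⟶-≈ˡ e (C , P , Q , f , r) = C , P , Q , ≈-trans e f , r

⟶*-≈ : M ≈ N → M ⟶* N
⟶*-≈ e = _ , ε , e

⟶*-trans : M ⟶* N → N ⟶* L → M ⟶* L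
⟶*-trans (K , ss , e) (K′ , ε , f)      = K , ss , ≈-trans e f
⟶*-trans (K , ss , e) (K′ , t ◅ ts , f) = K′ , ss ◅◅ (⟶-≈ˡ e t ◅ ts) , f

⟶*-cong : {c : Preterm → Preterm} → (∀ {M N} → M ≈ N → c M ≈ c N) →
          (C : Context → Context) → (∀ D L → plug (C D) L ≡ c (plug D L)) → M ⟶* N → c M ⟶* c N
⟶*-cong {c = c} c-cong C h (K , ss , e) = c K , gmap c step ss , c-cong e
  where
  step : M ⟶ N → c M ⟶ c N
  step (D , P , Q , e , f , r) =
    C D , P , Q , ≈-trans (c-cong e) (≡⇒≈ (sym (h D P))) , ≈-trans (c-cong f) (≡⇒≈ (sym (h D Q))) , r

⟶*-app : M ⟶* M′ → N ⟶* N′ → fold (app M N) ⟶* fold (app M′ N′)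
⟶*-app {M} {M′} {N} r s = ⟶*-trans
  (⟶*-cong {c = λ M → fold (app M N)} (λ e → ≈ᴺ⇒≈ (app e (≈-refl {N}))) (λ C → appˡ C N) (λ _ _ → refl) r)
  (⟶*-cong {c = λ N → fold (app M′ N)} (λ e → ≈ᴺ⇒≈ (app (≈-refl {M′}) e)) (appʳ M′) (λ _ _ → refl) s)

⟶*-lam : M ⟶* M′ → fold (lam M) ⟶* fold (lam M′)
⟶*-lam = ⟶*-cong {c = fold ∘ lam} (λ e → ≈ᴺ⇒≈ (lam e)) lam (λ _ _ → refl)

⟶*-lam↓ : M ⟶* M′ → fold (lam↓ M) ⟶* fold (lam↓ M′)
⟶*-lam↓ = ⟶*-cong {c = fold ∘ lam↓} (λ e → ≈ᴺ⇒≈ (lam↓ e)) lam↓ (λ _ _ → refl)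

⟶*-lam↑ : M ⟶* M′ → fold (lam↑ M) ⟶* fold (lam↑ M′)
⟶*-lam↑ = ⟶*-cong {c = fold ∘ lam↑} (λ e → ≈ᴺ⇒≈ (lam↑ e)) lam↑ (λ _ _ → refl)

⟶*-box↓ : M ⟶* M′ → fold (box↓ M) ⟶* fold (box↓ M′)
⟶*-box↓ = ⟶*-cong {c = fold ∘ box↓} (λ e → ≈ᴺ⇒≈ (box↓ e)) box↓ (λ _ _ → refl)

⟶*-↦ : L ↦ N → L ⟶* N
⟶*-↦ {L} {N} r = _ , (□ , L , N , ≈-refl {L} , ≈-refl {N} , r) ◅ ε , ≈-refl {N}

⟶*-resp : M ≈ M′ → M′ ⟶* N′ → N ≈ N′ → M ⟶* N
⟶*-resp e r f = ⟶*-trans (⟶*-≈ e) (⟶*-trans r (⟶*-≈ (≈-sym f)))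

mutual
  ⇛⇒⟶* : out M ⇛ out N → M ⟶* N
  ⇛⇒⟶* r = ⇛⇒⟶*ᴺ r ≈ᴺ-refl ≈ᴺ-refl

  ⇛⇒⟶*ᴺ : m ⇛ n → out M ≈ᴺ m → out N ≈ᴺ n → M ⟶* N
  ⇛⇒⟶*ᴺ (var {i})   e f = ⟶*-≈ (≈ᴺ⇒≈ (≈ᴺ-trans e (≈ᴺ-sym f)))
  ⇛⇒⟶*ᴺ (app r s)   e f = ⟶*-resp (≈ᴺ⇒≈ e) (⟶*-app (⇛⇒⟶* r) (⇛⇒⟶* s)) (≈ᴺ⇒≈ f)
  ⇛⇒⟶*ᴺ (lam r)     e f = ⟶*-resp (≈ᴺ⇒≈ e) (⟶*-lam (⇛⇒⟶* r)) (≈ᴺ⇒≈ f)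
  ⇛⇒⟶*ᴺ (lam↓ r)    e f = ⟶*-resp (≈ᴺ⇒≈ e) (⟶*-lam↓ (⇛⇒⟶* r)) (≈ᴺ⇒≈ f)
  ⇛⇒⟶*ᴺ (lam↑ r)    e f = ⟶*-resp (≈ᴺ⇒≈ e) (⟶*-lam↑ (⇛⇒⟶* r)) (≈ᴺ⇒≈ f)
  ⇛⇒⟶*ᴺ (box↓ r)    e f = ⟶*-resp (≈ᴺ⇒≈ e) (⟶*-box↓ (⇛⇒⟶* r)) (≈ᴺ⇒≈ f)
  ⇛⇒⟶*ᴺ (box↑ h)    e f = ⟶*-≈ (≈ᴺ⇒≈ (≈ᴺ-trans e (≈ᴺ-trans (box↑ h) (≈ᴺ-sym f))))
  ⇛⇒⟶*ᴺ (β x r s h) e f =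
    ⟶*-resp (≈ᴺ⇒≈ e) (β⇒⟶* x ≈ᴺ-refl ≈ᴺ-refl r s) (≈ᴺ⇒≈ (≈ᴺ-trans f (≈ᴺ-sym h)))

  β⇒⟶* : Redex κ m n A b → out M ≈ᴺ m → out N ≈ᴺ n → out A ⇛ out A′ → b ⇛[ κ ] out B′ →
         fold (app M N) ⟶* A′ [ B′ ]
  β⇒⟶* lin e f r (lin s) = ⟶*-trans
    (⟶*-app (⟶*-trans (⟶*-≈ (≈ᴺ⇒≈ e)) (⟶*-lam (⇛⇒⟶* r))) (⇛⇒⟶*ᴺ s f ≈ᴺ-refl)) (⟶*-↦ β)
  β⇒⟶* ↓ e f r (↓ s) = ⟶*-trans
    (⟶*-app (⟶*-trans (⟶*-≈ (≈ᴺ⇒≈ e)) (⟶*-lam↓ (⇛⇒⟶* r)))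
            (⟶*-trans (⟶*-≈ (≈ᴺ⇒≈ f)) (⟶*-box↓ (⇛⇒⟶* s)))) (⟶*-↦ β↓)
  β⇒⟶* ↑ e f r (↑ h) = ⟶*-trans
    (⟶*-app (⟶*-trans (⟶*-≈ (≈ᴺ⇒≈ e)) (⟶*-lam↑ (⇛⇒⟶* r)))
            (⟶*-≈ (≈ᴺ⇒≈ (≈ᴺ-trans f (box↑ (≈ᴺ⇒≈ h)))))) (⟶*-↦ β↑)

⊩-⇛ : Γ ⊩ᴺ out M → out M ⇛ out N → ∃[ Δ ] Γ ⊳ᴱ Δ × Δ ⊩ᴺ out N
⊩-⇛ d r = let Δ , g , d′ = ⊩-⟶* (⊩-in d) (⇛⇒⟶* r) in Δ , g , ⊩-out d′

Redex-≈ : Redex κ m n A b → m ≈ᴺ m′ → n ≈ᴺ n′ →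
          ∃[ A′ ] ∃[ b′ ] Redex κ m′ n′ A′ b′ × A ≈ A′ × b ≈ᴺ b′
Redex-≈ lin (lam h)  f        = _ , _ , lin , h , f
Redex-≈ ↓   (lam↓ h) (box↓ f) = _ , _ , ↓ , h , ≈⇒≈ᴺ f
Redex-≈ ↑   (lam↑ h) (box↑ f) = _ , _ , ↑ , h , ≈⇒≈ᴺ f

mutual
  ⇛-≈ : m ≈ᴺ m′ → m ⇛ n → n ≈ᴺ n′ → m′ ⇛ n′
  ⇛-≈ var       var         var         = var
  ⇛-≈ (app e f) (app r s)   (app g h)   = app (⇛-≈ (≈⇒≈ᴺ e) r (≈⇒≈ᴺ g)) (⇛-≈ (≈⇒≈ᴺ f) s (≈⇒≈ᴺ h))
  ⇛-≈ (lam e)   (lam r)     (lam g)     = lam (⇛-≈ (≈⇒≈ᴺ e) r (≈⇒≈ᴺ g))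
  ⇛-≈ (lam↓ e)  (lam↓ r)    (lam↓ g)    = lam↓ (⇛-≈ (≈⇒≈ᴺ e) r (≈⇒≈ᴺ g))
  ⇛-≈ (lam↑ e)  (lam↑ r)    (lam↑ g)    = lam↑ (⇛-≈ (≈⇒≈ᴺ e) r (≈⇒≈ᴺ g))
  ⇛-≈ (box↓ e)  (box↓ r)    (box↓ g)    = box↓ (⇛-≈ (≈⇒≈ᴺ e) r (≈⇒≈ᴺ g))
  ⇛-≈ (box↑ e)  (box↑ r)    (box↑ g)    = box↑ (≈-trans (≈-sym e) (≈-trans r g))
  ⇛-≈ (app e f) (β x r s h) g           =
    let _ , _ , x′ , a , b = Redex-≈ x (≈⇒≈ᴺ e) (≈⇒≈ᴺ f) in
    β x′ (⇛-≈ (≈⇒≈ᴺ a) r ≈ᴺ-refl) (⇛[]-≈ b s) (≈ᴺ-trans h g)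

  ⇛[]-≈ : b ≈ᴺ b₁ → b ⇛[ κ ] b′ → b₁ ⇛[ κ ] b′
  ⇛[]-≈ e (lin r) = lin (⇛-≈ e r ≈ᴺ-refl)
  ⇛[]-≈ e (↓ r)   = ↓ (⇛-≈ e r ≈ᴺ-refl)
  ⇛[]-≈ e (↑ h)   = ↑ (≈ᴺ-trans (≈ᴺ-sym e) h)

-- ⇛ is inductive while preterms may be infinite outside the boxes. The derivation, finite down to
-- the coinductive boxes, supplies the recursion.
⇛-refl : Γ ⊩ᴺ m → m ≈ᴺ n → m ⇛ n
⇛-refl (vr _ _)       var       = var
⇛-refl (ap _ _ _ d e) (app h k) = app (⇛-refl d (≈⇒≈ᴺ h)) (⇛-refl e (≈⇒≈ᴺ k))
⇛-refl (ll d)         (lam h)   = lam (⇛-refl d (≈⇒≈ᴺ h))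
⇛-refl (li _ d)       (lam↓ h)  = lam↓ (⇛-refl d (≈⇒≈ᴺ h))
⇛-refl (lc d)         (lam↑ h)  = lam↑ (⇛-refl d (≈⇒≈ᴺ h))
⇛-refl (mi _ _ d)     (box↓ h)  = box↓ (⇛-refl d (≈⇒≈ᴺ h))
⇛-refl (mc _ _ _)     (box↑ h)  = box↑ h

-- Surface reduction under renaming and substitution

Redex-rename : ∀ ρ → Redex κ m n A b →
               Redex κ (out (renameᴺ ρ m)) (out (renameᴺ ρ n)) (rename (ext ρ) A) (out (renameᴺ ρ b))
Redex-rename ρ lin = lin
Redex-rename ρ ↓   = ↓
Redex-rename ρ ↑   = ↑

mutual
  ⇛-rename : ∀ ρ → m ⇛ n → out (renameᴺ ρ m) ⇛ out (renameᴺ ρ n)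
  ⇛-rename ρ var       = var
  ⇛-rename ρ (app r s) = app (⇛-rename ρ r) (⇛-rename ρ s)
  ⇛-rename ρ (lam r)   = lam (⇛-rename (ext ρ) r)
  ⇛-rename ρ (lam↓ r)  = lam↓ (⇛-rename (ext ρ) r)
  ⇛-rename ρ (lam↑ r)  = lam↑ (⇛-rename (ext ρ) r)
  ⇛-rename ρ (box↓ r)  = box↓ (⇛-rename ρ r)
  ⇛-rename ρ (box↑ h)  = box↑ (rename-cong (λ _ → refl) h)
  ⇛-rename ρ (β {A′ = A} {B′ = B} x r s h) =
    β (Redex-rename ρ x) (⇛-rename (ext ρ) r) (⇛[]-rename ρ s)
      (≈ᴺ-trans (≈⇒≈ᴺ (rename-[] ρ A B)) (rename-congᴺ h))

  ⇛[]-rename : ∀ ρ → b ⇛[ κ ] b′ → out (renameᴺ ρ b) ⇛[ κ ] out (renameᴺ ρ b′)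
  ⇛[]-rename ρ (lin r) = lin (⇛-rename ρ r)
  ⇛[]-rename ρ (↓ r)   = ↓ (⇛-rename ρ r)
  ⇛[]-rename ρ (↑ h)   = ↑ (rename-congᴺ h)

Redex-subst : ∀ σ → Redex κ m n A b →
              Redex κ (out (substᴺ σ m)) (out (substᴺ σ n)) (subst (exts σ) A) (out (substᴺ σ b))
Redex-subst σ lin = lin
Redex-subst σ ↓   = ↓
Redex-subst σ ↑   = ↑

data Agreeing : Rel Preterm (lsuc 0ℓ) where
  agreeing : Γ ⊩ M → (∀ i → Γ i ≡ nothing ⊎ σ i ≈ τ i) → Agreeing (subst σ M) (subst τ M)

Split-nothing : Split π₁ π₂ nothing → π₁ ≡ nothing × π₂ ≡ nothing
Split-nothing (shared none) = refl , refl

exts-agreeing : (∀ i → Γ i ≡ nothing ⊎ σ i ≈ τ i) → ∀ i → (π ∙ Γ) i ≡ nothing ⊎ exts σ i ≈ exts τ i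
exts-agreeing h zero = inj₂ (λ _ → refl)
exts-agreeing h (suc i) with h i
... | inj₁ e = inj₁ e
... | inj₂ e = inj₂ (rename-cong (λ _ → refl) e)

agreeing-Layer : Γ ⊩ᴺ m → (∀ i → Γ i ≡ nothing ⊎ σ i ≈ τ i) →
                 Layer (UpTo≈ Agreeing) (out (substᴺ σ m)) (out (substᴺ τ m))
agreeing-Layer {Γ} (vr {i} u _) h with Γ i | u | h i
... | _ | _  | inj₂ e = Layer-map eq (≈⇒≈ᴺ e)
... | _ | () | inj₁ refl
agreeing-Layer {Γ} {σ = σ} {τ} (ap Γ₁ Γ₂ s d e) h = app (rel (agreeing (⊩-in d) h₁)) (rel (agreeing (⊩-in e) h₂))
  where
  h₁ : ∀ i → Γ₁ i ≡ nothing ⊎ σ i ≈ τ i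
  h₁ i with Γ i | s i | h i
  ... | _ | t | inj₁ refl = inj₁ (proj₁ (Split-nothing t))
  ... | _ | _ | inj₂ e    = inj₂ e
  h₂ : ∀ i → Γ₂ i ≡ nothing ⊎ σ i ≈ τ i
  h₂ i with Γ i | s i | h i
  ... | _ | t | inj₁ refl = inj₁ (proj₂ (Split-nothing t))
  ... | _ | _ | inj₂ e    = inj₂ e
agreeing-Layer (ll d)   h = lam (rel (agreeing (⊩-in d) (exts-agreeing h)))
agreeing-Layer (li _ d) h = lam↓ (rel (agreeing (⊩-in d) (exts-agreeing h)))
agreeing-Layer (lc d)   h = lam↑ (rel (agreeing (⊩-in d) (exts-agreeing h)))
agreeing-Layer {Γ} {σ = σ} {τ} (mi Δ u d) h = box↓ (rel (agreeing (⊩-in d) h′))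
  where
  h′ : ∀ i → Δ i ≡ nothing ⊎ σ i ≈ τ i
  h′ i with Δ i | Γ i | u i | h i
  ... | _ | _ | none | inj₁ refl = inj₁ refl
  ... | _ | _ | _    | inj₂ e    = inj₂ e
agreeing-Layer {Γ} {σ = σ} {τ} (mc Δ u d) h = box↑ (rel (agreeing d h′))
  where
  h′ : ∀ i → Δ i ≡ nothing ⊎ σ i ≈ τ i
  h′ i with Δ i | Γ i | u i | h i
  ... | _ | _ | none | inj₁ refl = inj₁ refl
  ... | _ | _ | _    | inj₂ e    = inj₂ e

-- An absent entry stays absent in all premises and no leaf can use it, so such a variable has no
-- occurrence, not even inside boxes.
subst-agree : Γ ⊩ M → (∀ i → Γ i ≡ nothing ⊎ σ i ≈ τ i) → subst σ M ≈ subst τ M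
subst-agree d h = bisimulation-upTo≈ Agreeing
  (λ { (agreeing d h) → agreeing-Layer (⊩-out d) h }) (agreeing d h)

-- Entries of the variables that do not occur inside a coinductive box.

data Outer : Maybe Pattern → Set where
  none : Outer nothing
  lin  : Outer (just lin)
  ↓    : Outer (just ↓)
  #    : Outer (just #)

-- A variable ↑x does not occur outside the coinductive boxes, so M need not reduce to N
-- there; a variable that may occur inside them has to keep its value.

record Compatible (π : Maybe Pattern) (M N : Preterm) : Set where
  constructor compatible
  field
    outside : π ≢ just ↑ → out M ⇛ out N
    inside  : M ≈ N ⊎ Outer π

open Compatible

Compatible-∙ : (∀ i → Compatible (Γ i) (σ i) (τ i)) → ∀ i → Compatible ((π ∙ Γ) i) (exts σ i) (exts τ i)
Compatible-∙ c zero = compatible (λ _ → var) (inj₁ λ _ → refl)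
Compatible-∙ c (suc i) with c i
... | compatible s (inj₁ e) = compatible (⇛-rename suc ∘ s) (inj₁ (rename-cong (λ _ → refl) e))
... | compatible s (inj₂ o) = compatible (⇛-rename suc ∘ s) (inj₂ o)

Compatible-Splitˡ : Split π₁ π₂ π → Compatible π M N → Compatible π₁ M N
Compatible-Splitˡ linΥ       c = c
Compatible-Splitˡ ↓Υ         c = c
Compatible-Splitˡ linΠ       c = compatible (λ _ → outside c λ ()) (inj₂ none)
Compatible-Splitˡ ↓Π         c = compatible (λ _ → outside c λ ()) (inj₂ none)
Compatible-Splitˡ (shared _) c = c

Compatible-Under↓ : Under↓ π₁ π → Compatible π M N → Compatible π₁ M N
Compatible-Under↓ none c = c
Compatible-Under↓ #Θ   c = compatible (λ _ → outside c λ ()) (inj₂ none)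
Compatible-Under↓ ↓Ξ   c = compatible (λ _ → outside c λ ()) (inj₂ lin)
Compatible-Under↓ ↑Ψ   c = c
Compatible-Under↓ †Φ   c = c

-- A variable available inside a coinductive box is ↑ or † outside it, hence not `Outer`, and so has
-- kept its value.
Compatible-Under↑ : Under↑ π₁ π → Compatible π M N → π₁ ≡ nothing ⊎ M ≈ N
Compatible-Under↑ none c = inj₁ refl
Compatible-Under↑ #Θ   c = inj₁ refl
Compatible-Under↑ ↑Ξ   (compatible _ (inj₁ e)) = inj₂ e
Compatible-Under↑ †Ψ   (compatible _ (inj₁ e)) = inj₂ e

Usable-≢↑ : Usable π → π ≢ just ↑
Usable-≢↑ () refl

mutual
  ⇛-subst : Γ ⊩ᴺ m → m ⇛ n → (∀ i → Compatible (Γ i) (σ i) (τ i)) →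
            out (substᴺ σ m) ⇛ out (substᴺ τ n)
  ⇛-subst (vr {i} u _) var c = outside (c i) (Usable-≢↑ u)
  ⇛-subst (ap _ _ t d e) (app r s) c =
    app (⇛-subst d r (λ i → Compatible-Splitˡ (t i) (c i)))
        (⇛-subst e s (λ i → Compatible-Splitˡ (Split-sym (t i)) (c i)))
  ⇛-subst (ll d)     (lam r)  c = lam (⇛-subst d r (Compatible-∙ c))
  ⇛-subst (li _ d)   (lam↓ r) c = lam↓ (⇛-subst d r (Compatible-∙ c))
  ⇛-subst (lc d)     (lam↑ r) c = lam↑ (⇛-subst d r (Compatible-∙ c))
  ⇛-subst (mi _ u d) (box↓ r) c = box↓ (⇛-subst d r (λ i → Compatible-Under↓ (u i) (c i)))
  ⇛-subst {τ = τ} (mc _ u d) (box↑ h) c =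
    box↑ (≈-trans (subst-agree d (λ i → Compatible-Under↑ (u i) (c i)))
                  (subst-cong (λ i → ≈-refl {τ i}) h))
  ⇛-subst {σ = σ} {τ} (ap _ _ t d e) (β {A′ = A} {B′ = B} x r s h) c =
    let r′ , s′ = ⇛-subst-β x d e r s (λ i → Compatible-Splitˡ (t i) (c i))
                    (λ i → Compatible-Splitˡ (Split-sym (t i)) (c i))
    in β (Redex-subst σ x) r′ s′
         (≈ᴺ-trans (≈⇒≈ᴺ (subst-[] τ A B)) (subst-congᴺ (λ i → ≈-refl {τ i}) h))

  ⇛-subst-β : Redex κ m n A b → Γ₁ ⊩ᴺ m → Γ₂ ⊩ᴺ n → out A ⇛ out A′ → b ⇛[ κ ] b′ →
              (∀ i → Compatible (Γ₁ i) (σ i) (τ i)) → (∀ i → Compatible (Γ₂ i) (σ i) (τ i)) →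
              out (subst (exts σ) A) ⇛ out (subst (exts τ) A′) ×
              out (substᴺ σ b) ⇛[ κ ] out (substᴺ τ b′)
  ⇛-subst-β lin (ll d) e r (lin s) c₁ c₂ = ⇛-subst d r (Compatible-∙ c₁) , lin (⇛-subst e s c₂)
  ⇛-subst-β ↓ (li _ d) (mi _ u e) r (↓ s) c₁ c₂ =
    ⇛-subst d r (Compatible-∙ c₁) , ↓ (⇛-subst e s (λ i → Compatible-Under↓ (u i) (c₂ i)))
  ⇛-subst-β {τ = τ} ↑ (lc d) (mc _ u e) r (↑ h) c₁ c₂ =
    ⇛-subst d r (Compatible-∙ c₁) ,
    ↑ (≈ᴺ-trans (≈⇒≈ᴺ (subst-agree e (λ i → Compatible-Under↑ (u i) (c₂ i))))
                (subst-congᴺ (λ i → ≈-refl {τ i}) h))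

data Bound : Kind → Maybe Pattern → Set where
  lin : Bound lin (just lin)
  ↓   : Bang π → Bound ↓ π
  ↑   : Bound ↑ (just ↑)

-- Reducing the body may turn the ↓ of its bound variable into #; λ↓ binds either, so the redex
-- keeps its kind.
Bound-⊳ : Bound κ π → π ⊳ π′ → Bound κ π′
Bound-⊳ b     same = b
Bound-⊳ (↓ _) ↓#   = ↓ #

⇛-[] : Γ ⊩ᴺ out A → Bound κ (Γ zero) → out A ⇛ out A′ → out B ⇛[ κ ] out B′ →
       out (A [ B ]) ⇛ out (A′ [ B′ ])
⇛-[] {Γ} {B = B} {B′ = B′} d b r s = ⇛-subst d r c
  where
  c₀ : Bound κ π → out B ⇛[ κ ] out B′ → Compatible π B B′
  c₀ lin   (lin s) = compatible (λ _ → s) (inj₂ lin)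
  c₀ (↓ #) (↓ s)   = compatible (λ _ → s) (inj₂ #)
  c₀ (↓ ↓) (↓ s)   = compatible (λ _ → s) (inj₂ ↓)
  -- The variable ↑x has no surface occurrence to be reduced; in the boxes its value is the same up
  -- to `≈`.
  c₀ ↑     (↑ h)   = compatible (λ ↑≢ → ⊥-elim (↑≢ refl)) (inj₁ (≈ᴺ⇒≈ h))
  c : ∀ i → Compatible (Γ i) (single B i) (single B′ i)
  c zero    = c₀ b s
  c (suc i) = compatible (λ _ → var) (inj₁ λ _ → refl)

Redex-⊩ : Redex κ m n A b → Γ₁ ⊩ᴺ m → Γ₂ ⊩ᴺ n →
          ∃[ π ] ∃[ Δ ] Bound κ π × π ∙ Γ₁ ⊩ᴺ out A × Δ ⊩ᴺ b
Redex-⊩ lin (ll d)   e          = _ , _ , lin , d , e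
Redex-⊩ ↓   (li b d) (mi _ _ e) = _ , _ , ↓ b , d , e
Redex-⊩ ↑   (lc d)   (mc _ _ e) = _ , _ , ↑ , d , ⊩-out e

Redex-unique : ∀ {κ′ A′ b′} → Redex κ m n A b → Redex κ′ m n A′ b′ → κ ≡ κ′ × A ≡ A′ × b ≡ b′
Redex-unique lin lin = refl , refl , refl
Redex-unique ↓   ↓   = refl , refl , refl
Redex-unique ↑   ↑   = refl , refl , refl

⇛-[]-reduct : π ∙ Γ ⊩ᴺ out A → Bound κ π → out A ⇛ out A′ → out A′ ⇛ out M → out B′ ⇛[ κ ] out N →
              out (A′ [ B′ ]) ⇛ out (M [ N ])
⇛-[]-reduct d b a r s = let _ , g , d′ = ⊩-⇛ d a in ⇛-[] d′ (Bound-⊳ b (g zero)) r s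

-- Diamond property and confluence on the surface

mutual
  diamond : Γ ⊩ᴺ m → m ⇛ n → m ⇛ l → ∃[ J ] n ⇛ out J × l ⇛ out J
  diamond (vr {i} _ _) var var = fold (var i) , var , var
  diamond (ap _ _ _ d e) (app r s) (app r′ s′) =
    let _ , t , t′ = diamond d r r′
        _ , u , u′ = diamond e s s′
    in fold (app _ _) , app t u , app t′ u′
  diamond (ll d) (lam r) (lam r′) = let _ , t , t′ = diamond d r r′ in fold (lam _) , lam t , lam t′
  diamond (li _ d) (lam↓ r) (lam↓ r′) = let _ , t , t′ = diamond d r r′ in fold (lam↓ _) , lam↓ t , lam↓ t′
  diamond (lc d) (lam↑ r) (lam↑ r′) = let _ , t , t′ = diamond d r r′ in fold (lam↑ _) , lam↑ t , lam↑ t′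
  diamond (mi _ _ d) (box↓ r) (box↓ r′) = let _ , t , t′ = diamond d r r′ in fold (box↓ _) , box↓ t , box↓ t′
  diamond (mc _ _ _) (box↑ {M} h) (box↑ h′) = fold (box↑ M) , box↑ (≈-sym h) , box↑ (≈-sym h′)
  diamond (ap _ _ _ d e) (app r s) (β x a b h) =
    let J , t , t′ = diamond-app-β d e x r s a b in J , t , ⇛-≈ h t′ ≈ᴺ-refl
  diamond (ap _ _ _ d e) (β x a b h) (app r s) =
    let J , t , t′ = diamond-app-β d e x r s a b in J , ⇛-≈ h t′ ≈ᴺ-refl , t
  diamond (ap _ _ _ d e) (β x a b h) (β x′ a′ b′ h′) with Redex-unique x x′
  ... | refl , refl , refl =
    let _ , _ , bd , dA , dB = Redex-⊩ x d e
        A , t , t′ = diamond dA a a′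
        B , u , u′ = diamond-arg dB b b′
    in A [ B ] , ⇛-≈ h (⇛-[]-reduct dA bd a t u) ≈ᴺ-refl , ⇛-≈ h′ (⇛-[]-reduct dA bd a′ t′ u′) ≈ᴺ-refl

  diamond-arg : Γ ⊩ᴺ b → b ⇛[ κ ] out B → b ⇛[ κ ] b₂ → ∃[ J ] out B ⇛[ κ ] out J × b₂ ⇛[ κ ] out J
  diamond-arg d (lin r) (lin s) = let J , t , u = diamond d r s in J , lin t , lin u
  diamond-arg d (↓ r)   (↓ s)   = let J , t , u = diamond d r s in J , ↓ t , ↓ u
  diamond-arg d (↑ h)   (↑ k)   = _ , ↑ ≈ᴺ-refl , ↑ (≈ᴺ-trans (≈ᴺ-sym k) h)

  diamond-app-β : Γ₁ ⊩ᴺ out M → Γ₂ ⊩ᴺ out N → Redex κ (out M) (out N) A b →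
                  out M ⇛ out M′ → out N ⇛ out N′ → out A ⇛ out A′ → b ⇛[ κ ] out B′ →
                  ∃[ J ] app M′ N′ ⇛ out J × out (A′ [ B′ ]) ⇛ out J
  diamond-app-β d e x r s a b =
    let _ , _ , A , B , x′ , t , u , t′ , u′ = diamond-redex d e x r s a b
        _ , _ , bd , dA , _ = Redex-⊩ x d e
    in A [ B ] , β x′ t u ≈ᴺ-refl , ⇛-[]-reduct dA bd a t′ u′

  -- Abstractions and boxes have no step at their root, so reducing function and argument preserves
  -- the redex, and the diamonds for body and argument can be substituted into each other.
  diamond-redex : Γ₁ ⊩ᴺ m → Γ₂ ⊩ᴺ n → Redex κ m n A b →
                  m ⇛ m′ → n ⇛ n′ → out A ⇛ out A′ → b ⇛[ κ ] b₂ →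
                  ∃[ A₁ ] ∃[ b₁ ] ∃[ A₃ ] ∃[ B₃ ] Redex κ m′ n′ A₁ b₁ ×
                  out A₁ ⇛ out A₃ × b₁ ⇛[ κ ] out B₃ × out A′ ⇛ out A₃ × b₂ ⇛[ κ ] out B₃
  diamond-redex (ll d) e lin (lam r) s a (lin b) =
    let _ , t , t′ = diamond d r a
        _ , u , u′ = diamond e s b
    in _ , _ , _ , _ , lin , t , lin u , t′ , lin u′
  diamond-redex (li _ d) (mi _ _ e) ↓ (lam↓ r) (box↓ s) a (↓ b) =
    let _ , t , t′ = diamond d r a
        _ , u , u′ = diamond e s b
    in _ , _ , _ , _ , ↓ , t , ↓ u , t′ , ↓ u′
  diamond-redex (lc d) e ↑ (lam↑ r) (box↑ h) a (↑ k) =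
    let _ , t , t′ = diamond d r a
    in _ , _ , _ , _ , ↑ , t , ↑ ≈ᴺ-refl , t′ , ↑ (≈ᴺ-trans (≈ᴺ-sym k) (≈⇒≈ᴺ h))

infix 4 _⇛*_

_⇛*_ : Rel Preterm 0ℓ
_⇛*_ = Star λ M N → out M ⇛ out N

⇛*⇒⟶* : M ⇛* N → M ⟶* N
⇛*⇒⟶* ε        = ⟶*-≈ (λ _ → refl)
⇛*⇒⟶* (r ◅ rs) = ⟶*-trans (⇛⇒⟶* r) (⇛*⇒⟶* rs)

⊩-⇛* : Γ ⊩ᴺ out M → M ⇛* N → ∃[ Δ ] Γ ⊳ᴱ Δ × Δ ⊩ᴺ out N
⊩-⇛* d rs = let Δ , g , d′ = ⊩-⟶* (⊩-in d) (⇛*⇒⟶* rs) in Δ , g , ⊩-out d′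

strip : Γ ⊩ᴺ out M → out M ⇛ out N → M ⇛* L → ∃[ J ] N ⇛* J × out L ⇛ out J
strip d r ε        = _ , ε , r
strip d r (s ◅ ss) =
  let _ , t , u = diamond d r s
      _ , _ , d′ = ⊩-⇛ d s
      J , ts , v = strip d′ u ss
  in J , t ◅ ts , v

⇛*-confluent : Γ ⊩ᴺ out M → M ⇛* N → M ⇛* L → ∃[ J ] N ⇛* J × L ⇛* J
⇛*-confluent d ε        ss = _ , ss , ε
⇛*-confluent d (r ◅ rs) ss =
  let _ , ts , u = strip d r ss
      _ , _ , d′ = ⊩-⇛ d r
      J , vs , ws = ⇛*-confluent d′ rs ts
  in J , vs , u ◅ ws

-- Standard infinitary reduction

infix 4 _⇒ˢ_

_⇒ˢ_ : Preterm → Preterm → Set₁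
_⇒ˢ_ = ν λ R M N → ∃[ E ] M ⇛* E × ⟨ R ⟩ out E ⇝ out N

⇝-map : {R : Rel Preterm ℓ} {S : Rel Preterm ℓ′} → (∀ {M N} → R M N → S M N) →
        ⟨ R ⟩ m ⇝ n → ⟨ S ⟩ m ⇝ n
⇝-map f var       = var
⇝-map f (app r s) = app (⇝-map f r) (⇝-map f s)
⇝-map f (lam r)   = lam (⇝-map f r)
⇝-map f (lam↓ r)  = lam↓ (⇝-map f r)
⇝-map f (lam↑ r)  = lam↑ (⇝-map f r)
⇝-map f (box↓ r)  = box↓ (⇝-map f r)
⇝-map f (box↑ r)  = box↑ (f r)

⇝-support : {S : Rel Preterm (lsuc 0ℓ)} → ⟨ S ⟩ m ⇝ n → Supported (λ R → ⟨ R ⟩ m ⇝ n) S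
⇝-support var       = support-⊥ var
⇝-support (app r s) = support-map (λ (r , s) → app r s) (support-× (⇝-support r) (⇝-support s))
⇝-support (lam r)   = support-map lam (⇝-support r)
⇝-support (lam↓ r)  = support-map lam↓ (⇝-support r)
⇝-support (lam↑ r)  = support-map lam↑ (⇝-support r)
⇝-support (box↓ r)  = support-map box↓ (⇝-support r)
⇝-support (box↑ s)  = support-map box↑ (support-leaf s)

⇒ˢ-out : M ⇒ˢ N → ∃[ E ] M ⇛* E × ⟨ _⇒ˢ_ ⟩ out E ⇝ out N
⇒ˢ-out (R , step , r) =
  let E , rs , s = step r in E , rs , ⇝-map (λ r → R , (λ {_} → step) , r) s

⇒ˢ-coinduction : (S : Rel Preterm (lsuc 0ℓ)) →
                 (∀ {M N} → S M N → ∃[ E ] M ⇛* E × ⟨ S ⟩ out E ⇝ out N) → S M N → M ⇒ˢ N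
⇒ˢ-coinduction S step = ν-coinduction S λ s →
  let E , rs , t = step s in support-map (λ t → E , rs , t) (⇝-support t)

⇒ˢ-in : M ⇛* L → ⟨ _⇒ˢ_ ⟩ out L ⇝ out N → M ⇒ˢ N
⇒ˢ-in rs s = ⇒ˢ-coinduction (λ M N → ∃[ E ] M ⇛* E × ⟨ _⇒ˢ_ ⟩ out E ⇝ out N)
  (λ (E , rs , s) → E , rs , ⇝-map ⇒ˢ-out s) (_ , rs , s)

⇒ˢ⇒⇒ : M ⇒ˢ N → M ⇒ N
⇒ˢ⇒⇒ (R , step , r) = R , (λ r → let E , rs , s = step r in E , ⇛*⇒⟶* rs , s) , r

⇝-≈ : {R : Rel Preterm ℓ} {S : Rel Preterm ℓ′} →
      (∀ {M M′ N N′} → M ≈ M′ → R M N → N ≈ N′ → S M′ N′) →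
      m ≈ᴺ m′ → ⟨ R ⟩ m ⇝ n → n ≈ᴺ n′ → ⟨ S ⟩ m′ ⇝ n′
⇝-≈ f var       var       var       = var
⇝-≈ f (app d e) (app r s) (app g h) =
  app (⇝-≈ f (≈⇒≈ᴺ d) r (≈⇒≈ᴺ g)) (⇝-≈ f (≈⇒≈ᴺ e) s (≈⇒≈ᴺ h))
⇝-≈ f (lam e)   (lam r)   (lam g)   = lam (⇝-≈ f (≈⇒≈ᴺ e) r (≈⇒≈ᴺ g))
⇝-≈ f (lam↓ e)  (lam↓ r)  (lam↓ g)  = lam↓ (⇝-≈ f (≈⇒≈ᴺ e) r (≈⇒≈ᴺ g))
⇝-≈ f (lam↑ e)  (lam↑ r)  (lam↑ g)  = lam↑ (⇝-≈ f (≈⇒≈ᴺ e) r (≈⇒≈ᴺ g))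
⇝-≈ f (box↓ e)  (box↓ r)  (box↓ g)  = box↓ (⇝-≈ f (≈⇒≈ᴺ e) r (≈⇒≈ᴺ g))
⇝-≈ f (box↑ e)  (box↑ r)  (box↑ g)  = box↑ (f e r g)

⇛*-≈ : M ≈ M′ → M ⇛* N → ∃[ N′ ] M′ ⇛* N′ × N ≈ N′
⇛*-≈ e ε                = _ , ε , e
⇛*-≈ {N = N} e (r ◅ rs) = N , ⇛-≈ (≈⇒≈ᴺ e) r ≈ᴺ-refl ◅ rs , ≈-refl {N}

data ⇒ˢ-UpTo≈ : Rel Preterm (lsuc 0ℓ) where
  upTo≈ : M ≈ M′ → M ⇒ˢ N → N ≈ N′ → ⇒ˢ-UpTo≈ M′ N′

⇒ˢ-≈ : M ≈ M′ → M ⇒ˢ N → N ≈ N′ → M′ ⇒ˢ N′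
⇒ˢ-≈ e r f = ⇒ˢ-coinduction ⇒ˢ-UpTo≈ step (upTo≈ e r f)
  where
  step : ⇒ˢ-UpTo≈ M N → ∃[ E ] M ⇛* E × ⟨ ⇒ˢ-UpTo≈ ⟩ out E ⇝ out N
  step (upTo≈ e r f) =
    let _ , rs , s = ⇒ˢ-out r
        E , rs′ , g = ⇛*-≈ e rs
    in E , rs′ , ⇝-≈ upTo≈ (≈⇒≈ᴺ g) s (≈⇒≈ᴺ f)

⇝ˢ-≈ : m ≈ᴺ m′ → ⟨ _⇒ˢ_ ⟩ m ⇝ n → n ≈ᴺ n′ → ⟨ _⇒ˢ_ ⟩ m′ ⇝ n′
⇝ˢ-≈ = ⇝-≈ ⇒ˢ-≈

data ⇒ˢ-Reflexive : Rel Preterm (lsuc 0ℓ) where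
  reflexive : Γ ⊩ M → M ≈ N → ⇒ˢ-Reflexive M N

reflexive-⇝ : Γ ⊩ᴺ m → m ≈ᴺ n → ⟨ ⇒ˢ-Reflexive ⟩ m ⇝ n
reflexive-⇝ (vr _ _)       var       = var
reflexive-⇝ (ap _ _ _ d e) (app h k) = app (reflexive-⇝ d (≈⇒≈ᴺ h)) (reflexive-⇝ e (≈⇒≈ᴺ k))
reflexive-⇝ (ll d)         (lam h)   = lam (reflexive-⇝ d (≈⇒≈ᴺ h))
reflexive-⇝ (li _ d)       (lam↓ h)  = lam↓ (reflexive-⇝ d (≈⇒≈ᴺ h))
reflexive-⇝ (lc d)         (lam↑ h)  = lam↑ (reflexive-⇝ d (≈⇒≈ᴺ h))
reflexive-⇝ (mi _ _ d)     (box↓ h)  = box↓ (reflexive-⇝ d (≈⇒≈ᴺ h))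
reflexive-⇝ (mc _ _ d)     (box↑ h)  = box↑ (reflexive d h)

⇝ˢ-refl : Γ ⊩ᴺ m → m ≈ᴺ n → ⟨ _⇒ˢ_ ⟩ m ⇝ n
⇝ˢ-refl d e = ⇝-map
  (⇒ˢ-coinduction ⇒ˢ-Reflexive (λ { (reflexive d e) → _ , ε , reflexive-⇝ (⊩-out d) (≈⇒≈ᴺ e) }))
  (reflexive-⇝ d e)

⇒ˢ-refl : Γ ⊩ M → M ≈ N → M ⇒ˢ N
⇒ˢ-refl d e = ⇒ˢ-in ε (⇝ˢ-refl (⊩-out d) (≈⇒≈ᴺ e))

-- Standard reduction under renaming and substitution

data ⇒ˢ-Renamed : Rel Preterm (lsuc 0ℓ) where
  renamed : ∀ ρ → M ⇒ˢ N → ⇒ˢ-Renamed (rename ρ M) (rename ρ N)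

renamed-⇝ : ∀ ρ → ⟨ _⇒ˢ_ ⟩ m ⇝ n → ⟨ ⇒ˢ-Renamed ⟩ out (renameᴺ ρ m) ⇝ out (renameᴺ ρ n)
renamed-⇝ ρ var       = var
renamed-⇝ ρ (app r s) = app (renamed-⇝ ρ r) (renamed-⇝ ρ s)
renamed-⇝ ρ (lam r)   = lam (renamed-⇝ (ext ρ) r)
renamed-⇝ ρ (lam↓ r)  = lam↓ (renamed-⇝ (ext ρ) r)
renamed-⇝ ρ (lam↑ r)  = lam↑ (renamed-⇝ (ext ρ) r)
renamed-⇝ ρ (box↓ r)  = box↓ (renamed-⇝ ρ r)
renamed-⇝ ρ (box↑ r)  = box↑ (renamed ρ r)

⇒ˢ-rename : ∀ ρ → M ⇒ˢ N → rename ρ M ⇒ˢ rename ρ N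
⇒ˢ-rename ρ r = ⇒ˢ-coinduction ⇒ˢ-Renamed step (renamed ρ r)
  where
  step : ⇒ˢ-Renamed M N → ∃[ E ] M ⇛* E × ⟨ ⇒ˢ-Renamed ⟩ out E ⇝ out N
  step (renamed ρ r) =
    let E , rs , s = ⇒ˢ-out r in rename ρ E , gmap (rename ρ) (⇛-rename ρ) rs , renamed-⇝ ρ s

⇝ˢ-rename : ∀ ρ → ⟨ _⇒ˢ_ ⟩ m ⇝ n → ⟨ _⇒ˢ_ ⟩ out (renameᴺ ρ m) ⇝ out (renameᴺ ρ n)
⇝ˢ-rename ρ s = ⇝-map (λ { (renamed ρ r) → ⇒ˢ-rename ρ r }) (renamed-⇝ ρ s)

-- A ⇝ derivation visits the whole surface of m and thereby shows it finite, which is what a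
-- reflexive step is built from. These steps serve as padding.
⇝⇒⇛ : {R : Rel Preterm ℓ} → ⟨ R ⟩ m ⇝ n → m ⇛ m
⇝⇒⇛ var       = var
⇝⇒⇛ (app r s) = app (⇝⇒⇛ r) (⇝⇒⇛ s)
⇝⇒⇛ (lam r)   = lam (⇝⇒⇛ r)
⇝⇒⇛ (lam↓ r)  = lam↓ (⇝⇒⇛ r)
⇝⇒⇛ (lam↑ r)  = lam↑ (⇝⇒⇛ r)
⇝⇒⇛ (box↓ r)  = box↓ (⇝⇒⇛ r)
⇝⇒⇛ (box↑ r)  = box↑ (λ _ → refl)

-- The shorter of the two sequences is padded with reflexive steps at its end.

⇛*-app : ∀ {X} → out X ≡ app M N → M ⇛* M′ → out M′ ⇛ out M′ → N ⇛* N′ → out N′ ⇛ out N′ →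
         ∃[ E ] X ⇛* E × out E ≡ app M′ N′
⇛*-app e ε r ε s = _ , ε , e
⇛*-app e rs@ε r (s′ ◅ ss) s =
  let E , ts , f = ⇛*-app {X = fold (app _ _)} refl rs r ss s
  in E , transport (_⇛ app _ _) (sym e) (app r s′) ◅ ts , f
⇛*-app e (r′ ◅ rs) r ss@ε s =
  let E , ts , f = ⇛*-app {X = fold (app _ _)} refl rs r ss s
  in E , transport (_⇛ app _ _) (sym e) (app r′ s) ◅ ts , f
⇛*-app e (r′ ◅ rs) r (s′ ◅ ss) s =
  let E , ts , f = ⇛*-app {X = fold (app _ _)} refl rs r ss s
  in E , transport (_⇛ app _ _) (sym e) (app r′ s′) ◅ ts , f

-- X is given through its node only: a substituted tree and the `fold` of its node are different
-- functions.
⇛*-unary : ∀ {X} (c : Preterm → Node) → (∀ M → out (fold (c M)) ≡ c M) →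
           (∀ {M N} → out M ⇛ out N → c M ⇛ c N) →
           out X ≡ c M → M ⇛* M′ → ∃[ E ] X ⇛* E × out E ≡ c M′
⇛*-unary c g h e ε = _ , ε , e
⇛*-unary c g h e (_◅_ {j = K} r rs) =
  let E , ts , f = ⇛*-unary {X = fold (c K)} c g h (g K) rs
  in E , (transport (_⇛ out (fold (c K))) (sym e) (transport (c _ ⇛_) (sym (g K)) (h r)) ◅ ts) , f

Typed : Preterm → Set₁
Typed M = ∃[ Γ ] Γ ⊩ M

-- Substituted trees are typed so as to have a derivation to recurse on, in whatever environment; †
-- everywhere suits every variable at once.
var-typed : Typed (fold (var i))
var-typed = (λ _ → just †) , ⊩-in (vr † (λ _ _ → †Ψ))

exts-typed : (∀ i → Typed (σ i)) → ∀ i → Typed (exts σ i)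
exts-typed h zero    = var-typed
exts-typed h (suc i) = let _ , d = h i in _ , ⊩-shift d

exts-⇒ˢ : (∀ i → σ i ⇒ˢ τ i) → ∀ i → exts σ i ⇒ˢ exts τ i
exts-⇒ˢ h zero    = ⇒ˢ-in ε var
exts-⇒ˢ h (suc i) = ⇒ˢ-rename suc (h i)

⇛*-subst : Γ ⊩ᴺ out M → M ⇛* N → (∀ i → Typed (σ i)) → subst σ M ⇛* subst σ N
⇛*-subst d ε        h = ε
⇛*-subst d (r ◅ rs) h =
  ⇛-subst d r (λ i → compatible (λ _ → ⇛-refl (⊩-out (proj₂ (h i))) ≈ᴺ-refl) (inj₁ (λ _ → refl))) ◅
  ⇛*-subst (proj₂ (proj₂ (⊩-⇛ d r))) rs h

data ⇒ˢ-Substituted : Rel Preterm (lsuc 0ℓ) where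
  standard    : M ⇒ˢ N → ⇒ˢ-Substituted M N
  substituted : Γ ⊩ M → M ⇒ˢ N → (∀ i → Typed (σ i)) → (∀ i → σ i ⇒ˢ τ i) →
                ⇒ˢ-Substituted (subst σ M) (subst τ N)

-- The finite reductions of the copies of σ i outside the boxes of m are gathered in
-- front of ⇝.

gather : Γ ⊩ᴺ m → ⟨ _⇒ˢ_ ⟩ m ⇝ n → (∀ i → Typed (σ i)) → (∀ i → σ i ⇒ˢ τ i) →
         ∃[ E ] substᴺ σ m ⇛* E × ⟨ ⇒ˢ-Substituted ⟩ out E ⇝ out (substᴺ τ n)
gather (vr {i} _ _) var h k = let E , rs , s = ⇒ˢ-out (k i) in E , rs , ⇝-map standard s
gather {σ = σ} (ap {M} {N} _ _ _ d e) (app r s) h k =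
  let _ , rs , r′ = gather d r h k
      _ , ss , s′ = gather e s h k
      E , ts , x = ⇛*-app {X = substᴺ σ (app M N)} refl rs (⇝⇒⇛ r′) ss (⇝⇒⇛ s′)
  in E , ts , transport (⟨ _ ⟩_⇝ app _ _) (sym x) (app r′ s′)
gather {σ = σ} (ll {M} d) (lam r) h k =
  let _ , rs , r′ = gather d r (exts-typed h) (exts-⇒ˢ k)
      E , ts , x = ⇛*-unary {X = substᴺ σ (lam M)} lam (λ _ → refl) lam refl rs
  in E , ts , transport (⟨ _ ⟩_⇝ lam _) (sym x) (lam r′)
gather {σ = σ} (li {M} _ d) (lam↓ r) h k =
  let _ , rs , r′ = gather d r (exts-typed h) (exts-⇒ˢ k)
      E , ts , x = ⇛*-unary {X = substᴺ σ (lam↓ M)} lam↓ (λ _ → refl) lam↓ refl rs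
  in E , ts , transport (⟨ _ ⟩_⇝ lam↓ _) (sym x) (lam↓ r′)
gather {σ = σ} (lc {M} d) (lam↑ r) h k =
  let _ , rs , r′ = gather d r (exts-typed h) (exts-⇒ˢ k)
      E , ts , x = ⇛*-unary {X = substᴺ σ (lam↑ M)} lam↑ (λ _ → refl) lam↑ refl rs
  in E , ts , transport (⟨ _ ⟩_⇝ lam↑ _) (sym x) (lam↑ r′)
gather {σ = σ} (mi {M} _ _ d) (box↓ r) h k =
  let _ , rs , r′ = gather d r h k
      E , ts , x = ⇛*-unary {X = substᴺ σ (box↓ M)} box↓ (λ _ → refl) box↓ refl rs
  in E , ts , transport (⟨ _ ⟩_⇝ box↓ _) (sym x) (box↓ r′)
gather (mc _ _ d) (box↑ r) h k = _ , ε , box↑ (substituted d r h k)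

-- The prefix of M is replayed under σ, with the typed trees σ i resting by reflexive steps; their
-- own prefixes follow by `gather`, and every box poses the same problem again.
⇒ˢ-subst : Γ ⊩ M → M ⇒ˢ N → (∀ i → Typed (σ i)) → (∀ i → σ i ⇒ˢ τ i) → subst σ M ⇒ˢ subst τ N
⇒ˢ-subst d r h k = ⇒ˢ-coinduction ⇒ˢ-Substituted step (substituted d r h k)
  where
  step : ⇒ˢ-Substituted M N → ∃[ E ] M ⇛* E × ⟨ ⇒ˢ-Substituted ⟩ out E ⇝ out N
  step (standard r) = let E , rs , s = ⇒ˢ-out r in E , rs , ⇝-map standard s
  step (substituted d r h k) =
    let _ , rs , s = ⇒ˢ-out r
        _ , _ , d′ = ⊩-⇛* (⊩-out d) rs
        E , ts , s′ = gather d′ s h k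
    in E , ⇛*-subst (⊩-out d) rs h ◅◅ ts , s′

-- A surface occurrence is replaced within a ⇝ derivation, which leaves no room for surface steps,
-- so ⇝ is required of its value. A variable ↑x occurs in boxes only, where ⇒ˢ is allowed.
record Reducing (π : Maybe Pattern) (M N : Preterm) : Set₁ where
  constructor reducing
  field
    origin : Typed M
    reduct : M ⇒ˢ N
    outer  : π ≡ just ↑ ⊎ ⟨ _⇒ˢ_ ⟩ out M ⇝ out N

open Reducing

Reducing-∙ : (∀ i → Reducing (Γ i) (σ i) (τ i)) → ∀ i → Reducing ((π ∙ Γ) i) (exts σ i) (exts τ i)
Reducing-∙ h zero = reducing var-typed (⇒ˢ-in ε var) (inj₂ var)
Reducing-∙ h (suc i) with h i
... | reducing (_ , d) r (inj₁ e) = reducing (_ , ⊩-shift d) (⇒ˢ-rename suc r) (inj₁ e)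
... | reducing (_ , d) r (inj₂ s) = reducing (_ , ⊩-shift d) (⇒ˢ-rename suc r) (inj₂ (⇝ˢ-rename suc s))

Reducing-Split : Split π₁ π₂ π → Reducing π M N → Reducing π₁ M N
Reducing-Split (shared _) r = r
Reducing-Split s (reducing d r (inj₂ t)) = reducing d r (inj₂ t)

Reducing-Under↓ : Under↓ π₁ π → Reducing π M N → Reducing π₁ M N
Reducing-Under↓ ↑Ψ r = r
Reducing-Under↓ u  (reducing d r (inj₂ t)) = reducing d r (inj₂ t)

⇝-subst : Γ ⊩ᴺ m → ⟨ _⇒ˢ_ ⟩ m ⇝ n → (∀ i → Reducing (Γ i) (σ i) (τ i)) →
          ⟨ _⇒ˢ_ ⟩ out (substᴺ σ m) ⇝ out (substᴺ τ n)
⇝-subst {Γ} (vr {i} u _) var h with Γ i | u | h i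
... | _ | _  | reducing _ _ (inj₂ s)    = s
... | _ | () | reducing _ _ (inj₁ refl)
⇝-subst (ap _ _ s d e) (app r r′) h =
  app (⇝-subst d r (λ i → Reducing-Split (s i) (h i)))
      (⇝-subst e r′ (λ i → Reducing-Split (Split-sym (s i)) (h i)))
⇝-subst (ll d)     (lam r)  h = lam (⇝-subst d r (Reducing-∙ h))
⇝-subst (li _ d)   (lam↓ r) h = lam↓ (⇝-subst d r (Reducing-∙ h))
⇝-subst (lc d)     (lam↑ r) h = lam↑ (⇝-subst d r (Reducing-∙ h))
⇝-subst (mi _ u d) (box↓ r) h = box↓ (⇝-subst d r (λ i → Reducing-Under↓ (u i) (h i)))
⇝-subst (mc _ _ d) (box↑ r) h = box↑ (⇒ˢ-subst d r (origin ∘ h) (reduct ∘ h))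

infix 4 _⇝[_]_

-- The argument of a λ↑ redex lies inside a box and may make surface steps of its own, hence ⇒ˢ;
-- `fold` is there because ⇒ˢ relates trees.
data _⇝[_]_ : Node → Kind → Node → Set₁ where
  lin : ⟨ _⇒ˢ_ ⟩ b ⇝ b′ → b ⇝[ lin ] b′
  ↓   : ⟨ _⇒ˢ_ ⟩ b ⇝ b′ → b ⇝[ ↓ ] b′
  ↑   : fold b ⇒ˢ fold b′ → b ⇝[ ↑ ] b′

fold-out : ∀ M → fold (out M) ≈ M
fold-out M = ≈ᴺ⇒≈ (transport (_≈ᴺ out M) (sym (out-fold (out M))) ≈ᴺ-refl)

⇝-[] : Γ ⊩ᴺ out A → Bound κ (Γ zero) → ⟨ _⇒ˢ_ ⟩ out A ⇝ out A′ → Δ ⊩ᴺ out B → out B ⇝[ κ ] out B′ →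
       ⟨ _⇒ˢ_ ⟩ out (A [ B ]) ⇝ out (A′ [ B′ ])
⇝-[] {Γ} {Δ = Δ} {B = B} {B′ = B′} d b r e s = ⇝-subst d r h
  where
  h₀ : Bound κ π → out B ⇝[ κ ] out B′ → Reducing π B B′
  h₀ lin   (lin s) = reducing (_ , ⊩-in e) (⇒ˢ-in ε s) (inj₂ s)
  h₀ (↓ _) (↓ s)   = reducing (_ , ⊩-in e) (⇒ˢ-in ε s) (inj₂ s)
  h₀ ↑     (↑ r)   = reducing (_ , ⊩-in e) (⇒ˢ-≈ (fold-out B) r (fold-out B′)) (inj₁ refl)
  h : ∀ i → Reducing (Γ i) (single B i) (single B′ i)
  h zero    = h₀ b s
  h (suc i) = reducing var-typed (⇒ˢ-in ε var) (inj₂ var)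

out-fold-≈ᴺ : ∀ n → out (fold n) ≈ᴺ n
out-fold-≈ᴺ n = transport (out (fold n) ≈ᴺ_) (out-fold n) ≈ᴺ-refl

⊩-⇛[] : Γ ⊩ᴺ b → b ⇛[ κ ] out B → ∃[ Δ ] Δ ⊩ᴺ out B
⊩-⇛[] {b = b} d (lin r) =
  let Δ , _ , d′ = ⊩-⟶* (⊩-in (weakenᴺ d (λ _ → same) (≈ᴺ-sym (out-fold-≈ᴺ b))))
                     (⇛⇒⟶*ᴺ r (out-fold-≈ᴺ b) ≈ᴺ-refl)
  in Δ , ⊩-out d′
⊩-⇛[] {b = b} d (↓ r) = ⊩-⇛[] d (lin r)
⊩-⇛[] d (↑ h) = _ , weakenᴺ d (λ _ → same) h

⇝-[]-reduct : Redex κ m n A b → Γ₁ ⊩ᴺ m → Γ₂ ⊩ᴺ n → out A ⇛ out A′ → b ⇛[ κ ] out B →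
              ⟨ _⇒ˢ_ ⟩ out A′ ⇝ out M → out B ⇝[ κ ] out N → ⟨ _⇒ˢ_ ⟩ out (A′ [ B ]) ⇝ out (M [ N ])
⇝-[]-reduct x d e a b r s =
  let _ , _ , bd , dA , dB = Redex-⊩ x d e
      _ , g , dA′ = ⊩-⇛ dA a
  in ⇝-[] dA′ (Bound-⊳ bd (g zero)) r (proj₂ (⊩-⇛[] dB b)) s

Redex-⇝ : Redex κ m n A b → ⟨ _⇒ˢ_ ⟩ m ⇝ m′ → ⟨ _⇒ˢ_ ⟩ n ⇝ n′ →
          ∃[ A′ ] ∃[ b′ ] Redex κ m′ n′ A′ b′ × ⟨ _⇒ˢ_ ⟩ out A ⇝ out A′ × b ⇝[ κ ] b′
Redex-⇝ lin (lam r) s = _ , _ , lin , r , lin s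
Redex-⇝ ↓ (lam↓ r) (box↓ s) = _ , _ , ↓ , r , ↓ s
Redex-⇝ ↑ (lam↑ r) (box↑ {M} {N} s) =
  _ , _ , ↑ , r , ↑ (⇒ˢ-≈ (≈-sym (fold-out M)) s (≈-sym (fold-out N)))

Redex-⇜ : Redex κ m′ n′ A′ b′ → ⟨ _⇒ˢ_ ⟩ m ⇝ m′ → ⟨ _⇒ˢ_ ⟩ n ⇝ n′ →
          ∃[ A ] ∃[ b ] Redex κ m n A b × ⟨ _⇒ˢ_ ⟩ out A ⇝ out A′ × b ⇝[ κ ] b′
Redex-⇜ lin (lam r) s = _ , _ , lin , r , lin s
Redex-⇜ ↓ (lam↓ r) (box↓ s) = _ , _ , ↓ , r , ↓ s
Redex-⇜ ↑ (lam↑ r) (box↑ {M} {N} s) =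
  _ , _ , ↑ , r , ↑ (⇒ˢ-≈ (≈-sym (fold-out M)) s (≈-sym (fold-out N)))

fold-cong : m ≈ᴺ n → fold m ≈ fold n
fold-cong {m} {n} e = ≈ᴺ⇒≈ (≈ᴺ-trans (out-fold-≈ᴺ m) (≈ᴺ-trans e (≈ᴺ-sym (out-fold-≈ᴺ n))))

-- Exchanging surface steps and steps inside boxes

mutual
  -- ⇝ leaves every node outside the boxes in place, so a surface redex of n is already one of m.
  -- Contracting it earlier moves the contents of a box only into other boxes, where their pending
  -- reduction can still be done.
  postpone : Γ ⊩ᴺ m → ⟨ _⇒ˢ_ ⟩ m ⇝ n → n ⇛ n′ → ∃[ E ] m ⇛ out E × ⟨ _⇒ˢ_ ⟩ out E ⇝ n′
  postpone _ (var {i}) var = fold (var i) , var , var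
  postpone (ap _ _ _ d e) (app r s) (app t u) =
    let _ , t′ , r′ = postpone d r t
        _ , u′ , s′ = postpone e s u
    in fold (app _ _) , app t′ u′ , app r′ s′
  postpone (ll d) (lam r) (lam t) = let _ , t′ , r′ = postpone d r t in fold (lam _) , lam t′ , lam r′
  postpone (li _ d) (lam↓ r) (lam↓ t) = let _ , t′ , r′ = postpone d r t in fold (lam↓ _) , lam↓ t′ , lam↓ r′
  postpone (lc d) (lam↑ r) (lam↑ t) = let _ , t′ , r′ = postpone d r t in fold (lam↑ _) , lam↑ t′ , lam↑ r′
  postpone (mi _ _ d) (box↓ r) (box↓ t) = let _ , t′ , r′ = postpone d r t in fold (box↓ _) , box↓ t′ , box↓ r′
  postpone _ (box↑ {M} r) (box↑ h) = fold (box↑ M) , box↑ (≈-refl {M}) , box↑ (⇒ˢ-≈ (≈-refl {M}) r h)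
  postpone (ap _ _ _ d e) (app r s) (β x t u h) =
    let _ , _ , x′ , r′ , s′ = Redex-⇜ x r s
        _ , _ , _ , dA , dB = Redex-⊩ x′ d e
        A , t′ , r″ = postpone dA r′ t
        B , u′ , s″ = postpone-arg dB s′ u
    in A [ B ] , β x′ t′ u′ ≈ᴺ-refl , ⇝ˢ-≈ ≈ᴺ-refl (⇝-[]-reduct x′ d e t′ u′ r″ s″) h

  postpone-arg : Γ ⊩ᴺ b → b ⇝[ κ ] b₁ → b₁ ⇛[ κ ] b₂ → ∃[ B ] b ⇛[ κ ] out B × out B ⇝[ κ ] b₂
  postpone-arg d (lin r) (lin s) = let E , s′ , r′ = postpone d r s in E , lin s′ , lin r′
  postpone-arg d (↓ r)   (↓ s)   = let E , s′ , r′ = postpone d r s in E , ↓ s′ , ↓ r′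
  postpone-arg {b = b} d (↑ r) (↑ h) =
    fold b , ↑ (≈ᴺ-sym (out-fold-≈ᴺ b)) , ↑ (⇒ˢ-≈ (fold-cong (≈ᴺ-sym (out-fold-≈ᴺ b))) r (fold-cong h))

mutual
  -- The redex contracted in m survives in n for the same reason. One step answers one step, since ⇝
  -- neither copies nor erases surface redexes; so the extension to sequences is a plain induction.
  commute : Γ ⊩ᴺ m → ⟨ _⇒ˢ_ ⟩ m ⇝ n → m ⇛ m′ → ∃[ E ] n ⇛ out E × ⟨ _⇒ˢ_ ⟩ m′ ⇝ out E
  commute _ (var {i}) var = fold (var i) , var , var
  commute (ap _ _ _ d e) (app r s) (app t u) =
    let _ , t′ , r′ = commute d r t
        _ , u′ , s′ = commute e s u
    in fold (app _ _) , app t′ u′ , app r′ s′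
  commute (ll d) (lam r) (lam t) = let _ , t′ , r′ = commute d r t in fold (lam _) , lam t′ , lam r′
  commute (li _ d) (lam↓ r) (lam↓ t) = let _ , t′ , r′ = commute d r t in fold (lam↓ _) , lam↓ t′ , lam↓ r′
  commute (lc d) (lam↑ r) (lam↑ t) = let _ , t′ , r′ = commute d r t in fold (lam↑ _) , lam↑ t′ , lam↑ r′
  commute (mi _ _ d) (box↓ r) (box↓ t) = let _ , t′ , r′ = commute d r t in fold (box↓ _) , box↓ t′ , box↓ r′
  commute _ (box↑ {N = N} r) (box↑ h) = fold (box↑ N) , box↑ (≈-refl {N}) , box↑ (⇒ˢ-≈ h r (≈-refl {N}))
  commute (ap _ _ _ d e) (app r s) (β x t u h) =
    let _ , _ , x′ , r′ , s′ = Redex-⇝ x r s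
        _ , _ , _ , dA , dB = Redex-⊩ x d e
        A , t′ , r″ = commute dA r′ t
        B , u′ , s″ = commute-arg dB s′ u
    in A [ B ] , β x′ t′ u′ ≈ᴺ-refl , ⇝ˢ-≈ h (⇝-[]-reduct x d e t u r″ s″) ≈ᴺ-refl

  commute-arg : Γ ⊩ᴺ b → b ⇝[ κ ] b₁ → b ⇛[ κ ] b₂ → ∃[ B ] b₁ ⇛[ κ ] out B × b₂ ⇝[ κ ] out B
  commute-arg d (lin r) (lin s) = let E , s′ , r′ = commute d r s in E , lin s′ , lin r′
  commute-arg d (↓ r)   (↓ s)   = let E , s′ , r′ = commute d r s in E , ↓ s′ , ↓ r′
  commute-arg {b₁ = b₁} d (↑ r) (↑ h) =
    fold b₁ , ↑ (≈ᴺ-sym (out-fold-≈ᴺ b₁)) , ↑ (⇒ˢ-≈ (fold-cong h) r (fold-cong (≈ᴺ-sym (out-fold-≈ᴺ b₁))))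

postpone* : Γ ⊩ᴺ out M → ⟨ _⇒ˢ_ ⟩ out M ⇝ out N → N ⇛* L → ∃[ E ] M ⇛* E × ⟨ _⇒ˢ_ ⟩ out E ⇝ out L
postpone* d r ε        = _ , ε , r
postpone* d r (s ◅ ss) =
  let _ , t , r′ = postpone d r s
      E , ts , r″ = postpone* (proj₂ (proj₂ (⊩-⇛ d t))) r′ ss
  in E , t ◅ ts , r″

commute* : Γ ⊩ᴺ out M → ⟨ _⇒ˢ_ ⟩ out M ⇝ out N → M ⇛* L → ∃[ E ] N ⇛* E × ⟨ _⇒ˢ_ ⟩ out L ⇝ out E
commute* d r ε        = _ , ε , r
commute* d r (s ◅ ss) =
  let _ , t , r′ = commute d r s
      E , ts , r″ = commute* (proj₂ (proj₂ (⊩-⇛ d s))) r′ ss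
  in E , t ◅ ts , r″

-- Transitivity and subject reduction for standard reduction

module _ (R : Rel Preterm ℓ) where

  -- R is `_⇒ˢ_` in the proof of transitivity, and the witness relation of a given M ⇒ N when that
  -- reduction is standardised.
  data Composite : Rel Preterm (lsuc 0ℓ ⊔ ℓ) where
    compose : Γ ⊩ M → M ⇒ˢ N → R N L → Composite M L

  compose-⇝ : Γ ⊩ᴺ m → ⟨ _⇒ˢ_ ⟩ m ⇝ n → ⟨ R ⟩ n ⇝ l → ⟨ Composite ⟩ m ⇝ l
  compose-⇝ _               var       var         = var
  compose-⇝ (ap _ _ _ d e) (app r s) (app r′ s′) = app (compose-⇝ d r r′) (compose-⇝ e s s′)
  compose-⇝ (ll d)         (lam r)   (lam r′)    = lam (compose-⇝ d r r′)
  compose-⇝ (li _ d)       (lam↓ r)  (lam↓ r′)   = lam↓ (compose-⇝ d r r′)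
  compose-⇝ (lc d)         (lam↑ r)  (lam↑ r′)   = lam↑ (compose-⇝ d r r′)
  compose-⇝ (mi _ _ d)     (box↓ r)  (box↓ r′)   = box↓ (compose-⇝ d r r′)
  compose-⇝ (mc _ _ d)     (box↑ r)  (box↑ r′)   = box↑ (compose d r r′)

-- Between the two surface prefixes stands the box part of the first reduction. `postpone*` moves it
-- behind the second prefix, where the two box parts form new composites.
⇒ˢ-trans : Γ ⊩ M → M ⇒ˢ N → N ⇒ˢ L → M ⇒ˢ L
⇒ˢ-trans d r s = ⇒ˢ-coinduction (Composite _⇒ˢ_) step (compose d r s)
  where
  step : Composite _⇒ˢ_ M N → ∃[ E ] M ⇛* E × ⟨ Composite _⇒ˢ_ ⟩ out E ⇝ out N
  step (compose d r s) =
    let _ , rs , t = ⇒ˢ-out r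
        _ , ss , u = ⇒ˢ-out s
        _ , _ , d′ = ⊩-⇛* (⊩-out d) rs
        E , ts , t′ = postpone* d′ t ss
        _ , _ , d″ = ⊩-⇛* d′ ts
    in E , rs ◅◅ ts , compose-⇝ _ d″ t′ u

data ⇝-Typed : Ctx → Preterm → Set₁ where
  ⇝-typed : Γ ⊩ᴺ out M → ⟨ _⇒ˢ_ ⟩ out M ⇝ out N → ⇝-Typed Γ N

⇝-typed-Der : Γ ⊩ᴺ m → ⟨ _⇒ˢ_ ⟩ m ⇝ n → Der ⇝-Typed Γ n
⇝-typed-Der (vr u s)         var       = vr u s
⇝-typed-Der (ap Γ₁ Γ₂ s d e) (app r t) = ap Γ₁ Γ₂ s (⇝-typed-Der d r) (⇝-typed-Der e t)
⇝-typed-Der (ll d)           (lam r)   = ll (⇝-typed-Der d r)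
⇝-typed-Der (li b d)         (lam↓ r)  = li b (⇝-typed-Der d r)
⇝-typed-Der (lc d)           (lam↑ r)  = lc (⇝-typed-Der d r)
⇝-typed-Der (mi Δ u d)       (box↓ r)  = mi Δ u (⇝-typed-Der d r)
⇝-typed-Der (mc Δ u d)       (box↑ r)  =
  let _ , rs , s = ⇒ˢ-out r
      _ , g , d′ = ⊩-⇛* (⊩-out d) rs
  in mc Δ u (⇝-typed (weakenᴺ d′ (λ j → Under↑-⊳ (u j) (g j)) ≈ᴺ-refl) s)

-- Only the finite surface prefix can change the environment. The rest takes place in boxes, where ⊳
-- is trivial, so the derivation of the limit is rebuilt corecursively in one fixed environment.
⊩-⇒ˢ : Γ ⊩ M → M ⇒ˢ N → ∃[ Δ ] Γ ⊳ᴱ Δ × Δ ⊩ N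
⊩-⇒ˢ d r =
  let _ , rs , s = ⇒ˢ-out r
      Δ , g , d′ = ⊩-⇛* (⊩-out d) rs
  in Δ , g , ⊩-coinduction ⇝-Typed (λ { (⇝-typed d s) → ⇝-typed-Der d s }) (⇝-typed d′ s)

-- Standardisation

⇛-↦ : L ↦ N → Γ ⊩ᴺ out L → out L ⇛ out N
⇛-↦ β  (ap _ _ _ (ll d) e)            = β lin (⇛-refl d ≈ᴺ-refl) (lin (⇛-refl e ≈ᴺ-refl)) ≈ᴺ-refl
⇛-↦ β↓ (ap _ _ _ (li _ d) (mi _ _ e)) = β ↓ (⇛-refl d ≈ᴺ-refl) (↓ (⇛-refl e ≈ᴺ-refl)) ≈ᴺ-refl
⇛-↦ β↑ (ap _ _ _ (lc d) e)            = β ↑ (⇛-refl d ≈ᴺ-refl) (↑ ≈ᴺ-refl) ≈ᴺ-refl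

-- The hole is either outside all coinductive boxes, which gives a surface step, or inside one,
-- where the step turns into a standard reduction of the contents. The other subterms rest by
-- reflexivity.
plug-step : ∀ C → L ↦ N → Γ ⊩ᴺ out (plug C L) →
            out (plug C L) ⇛ out (plug C N) ⊎ ⟨ _⇒ˢ_ ⟩ out (plug C L) ⇝ out (plug C N)
plug-step □ r d = inj₁ (⇛-↦ r d)
plug-step (appˡ C K) r (ap _ _ _ d e) with plug-step C r d
... | inj₁ s = inj₁ (app s (⇛-refl e ≈ᴺ-refl))
... | inj₂ s = inj₂ (app s (⇝ˢ-refl e ≈ᴺ-refl))
plug-step (appʳ K C) r (ap _ _ _ d e) with plug-step C r e
... | inj₁ s = inj₁ (app (⇛-refl d ≈ᴺ-refl) s)
... | inj₂ s = inj₂ (app (⇝ˢ-refl d ≈ᴺ-refl) s)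
plug-step (lam C) r (ll d) with plug-step C r d
... | inj₁ s = inj₁ (lam s)
... | inj₂ s = inj₂ (lam s)
plug-step (lam↓ C) r (li _ d) with plug-step C r d
... | inj₁ s = inj₁ (lam↓ s)
... | inj₂ s = inj₂ (lam↓ s)
plug-step (lam↑ C) r (lc d) with plug-step C r d
... | inj₁ s = inj₁ (lam↑ s)
... | inj₂ s = inj₂ (lam↑ s)
plug-step (box↓ C) r (mi _ _ d) with plug-step C r d
... | inj₁ s = inj₁ (box↓ s)
... | inj₂ s = inj₂ (box↓ s)
plug-step (box↑ C) r (mc _ _ d) with plug-step C r (⊩-out d)
... | inj₁ s =
  let _ , _ , d′ = ⊩-⇛ (⊩-out d) s in inj₂ (box↑ (⇒ˢ-in (s ◅ ε) (⇝ˢ-refl d′ ≈ᴺ-refl)))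
... | inj₂ s = inj₂ (box↑ (⇒ˢ-in ε s))

⟶⇒⇒ˢ : Γ ⊩ M → M ⟶ N → M ⇒ˢ N
⟶⇒⇒ˢ d (C , L , P , e , f , r) with
  weakenᴺ (⊩-out d) (λ _ → same) (≈⇒≈ᴺ e)
... | d′ with plug-step C r d′
... | inj₁ s = let _ , _ , d″ = ⊩-⇛ d′ s in
               ⇒ˢ-≈ (≈-sym e) (⇒ˢ-in (s ◅ ε) (⇝ˢ-refl d″ ≈ᴺ-refl)) (≈-sym f)
... | inj₂ s = ⇒ˢ-≈ (≈-sym e) (⇒ˢ-in ε s) (≈-sym f)

⟶*⇒⇒ˢ : Γ ⊩ M → M ⟶* N → M ⇒ˢ N
⟶*⇒⇒ˢ d (K , ε , e)      = ⇒ˢ-refl d e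
⟶*⇒⇒ˢ d (K , r ◅ rs , e) =
  let _ , _ , d′ = ⊩-⟶ d r in ⇒ˢ-trans d (⟶⇒⇒ˢ d r) (⟶*⇒⇒ˢ d′ (K , rs , e))

-- The invariant is a standard reduction accumulated so far, followed by an unprocessed remainder in
-- R. Unfolding the remainder exposes a finite ⟶*, which transitivity absorbs; the surface prefix of
-- the result is emitted, and each box receives its share of the accumulated reduction and of the
-- remainder.
⇒⇒⇒ˢ : Γ ⊩ M → M ⇒ N → M ⇒ˢ N
⇒⇒⇒ˢ d (R , unfold , r) =
  ⇒ˢ-coinduction (Composite R) step (compose d (⇒ˢ-refl d (λ _ → refl)) r)
  where
  step : Composite R M N → ∃[ E ] M ⇛* E × ⟨ Composite R ⟩ out E ⇝ out N
  step (compose d r s) =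
    let _ , ss , t = unfold s
        _ , _ , d′ = ⊩-⇒ˢ d r
        E , rs , u = ⇒ˢ-out (⇒ˢ-trans d r (⟶*⇒⇒ˢ d′ ss))
        _ , _ , d″ = ⊩-⇛* (⊩-out d) rs
    in E , rs , compose-⇝ R d″ u t

-- Confluence

record Meet (N L : Preterm) : Set₁ where
  constructor meeting
  field
    {context} : Ctx
    {J N₁ L₁} : Preterm
    J-typed   : context ⊩ᴺ out J
    N⇛*N₁     : N ⇛* N₁
    L⇛*L₁     : L ⇛* L₁
    J⇝N₁      : ⟨ _⇒ˢ_ ⟩ out J ⇝ out N₁
    J⇝L₁      : ⟨ _⇒ˢ_ ⟩ out J ⇝ out L₁

meet : Γ ⊩ M → M ⇒ˢ N → M ⇒ˢ L → Meet N L
meet d r s =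
  let _ , rs , t = ⇒ˢ-out r
      _ , ss , u = ⇒ˢ-out s
      _ , rs′ , ss′ = ⇛*-confluent (⊩-out d) rs ss
      _ , _ , dE = ⊩-⇛* (⊩-out d) rs
      _ , _ , dF = ⊩-⇛* (⊩-out d) ss
      _ , _ , dJ = ⊩-⇛* dE rs′
      _ , ts , t′ = commute* dE t rs′
      _ , us , u′ = commute* dF u ss′
  in meeting dJ ts us t′ u′

-- In a box, the peak formed by the two reductions of its contents is closed in turn;
-- this is productive because every call moves down the path.

joinᴺ : Γ ⊩ᴺ m → ⟨ _⇒ˢ_ ⟩ m ⇝ n → ⟨ _⇒ˢ_ ⟩ m ⇝ l → Preterm
joinᴺ _               (var {i})   _         _           = var i
joinᴺ (ap _ _ _ _ _) (app _ _)   (app _ _) []          = app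
joinᴺ (ap _ _ _ d _) (app r _)   (app s _) (left ∷ p)  = joinᴺ d r s p
joinᴺ (ap _ _ _ _ e) (app _ r)   (app _ s) (right ∷ p) = joinᴺ e r s p
joinᴺ (ll _)         (lam _)     (lam _)   []          = lam
joinᴺ (ll d)         (lam r)     (lam s)   (_ ∷ p)     = joinᴺ d r s p
joinᴺ (li _ _)       (lam↓ _)    (lam↓ _)  []          = lam↓
joinᴺ (li _ d)       (lam↓ r)    (lam↓ s)  (_ ∷ p)     = joinᴺ d r s p
joinᴺ (lc _)         (lam↑ _)    (lam↑ _)  []          = lam↑
joinᴺ (lc d)         (lam↑ r)    (lam↑ s)  (_ ∷ p)     = joinᴺ d r s p
joinᴺ (mi _ _ _)     (box↓ _)    (box↓ _)  []          = box↓
joinᴺ (mi _ _ d)     (box↓ r)    (box↓ s)  (_ ∷ p)     = joinᴺ d r s p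
joinᴺ (mc _ _ _)     (box↑ _)    (box↑ _)  []          = box↑
joinᴺ (mc _ _ d)     (box↑ r)    (box↑ s)  (_ ∷ p)     =
  let meeting dJ _ _ t u = meet d r s in joinᴺ dJ t u p

join : Meet N L → Preterm
join (meeting dJ _ _ t u) = joinᴺ dJ t u

data Joined : Rel Preterm (lsuc 0ℓ) where
  joinedˡ : (x : Meet N L) → Joined N (join x)
  joinedʳ : (x : Meet N L) → Joined L (join x)

joined-⇝ : (d : Γ ⊩ᴺ m) (r : ⟨ _⇒ˢ_ ⟩ m ⇝ n) (s : ⟨ _⇒ˢ_ ⟩ m ⇝ l) →
           ⟨ Joined ⟩ n ⇝ out (joinᴺ d r s) × ⟨ Joined ⟩ l ⇝ out (joinᴺ d r s)
joined-⇝ (vr _ _) var var = var , var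
joined-⇝ (ap _ _ _ d e) (app r r′) (app s s′) =
  let x , y = joined-⇝ d r s
      x′ , y′ = joined-⇝ e r′ s′
  in app x x′ , app y y′
joined-⇝ (ll d)     (lam r)  (lam s)  = let x , y = joined-⇝ d r s in lam x , lam y
joined-⇝ (li _ d)   (lam↓ r) (lam↓ s) = let x , y = joined-⇝ d r s in lam↓ x , lam↓ y
joined-⇝ (lc d)     (lam↑ r) (lam↑ s) = let x , y = joined-⇝ d r s in lam↑ x , lam↑ y
joined-⇝ (mi _ _ d) (box↓ r) (box↓ s) = let x , y = joined-⇝ d r s in box↓ x , box↓ y
joined-⇝ (mc _ _ d) (box↑ r) (box↑ s) = box↑ (joinedˡ (meet d r s)) , box↑ (joinedʳ (meet d r s))

joined-⇒ˢ : Joined M N → M ⇒ˢ N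
joined-⇒ˢ = ⇒ˢ-coinduction Joined step
  where
  step : Joined M N → ∃[ E ] M ⇛* E × ⟨ Joined ⟩ out E ⇝ out N
  step (joinedˡ (meeting d rs ss t u)) = _ , rs , proj₁ (joined-⇝ d t u)
  step (joinedʳ (meeting d rs ss t u)) = _ , ss , proj₂ (joined-⇝ d t u)

⇒ˢ-confluent : Γ ⊩ M → M ⇒ˢ N → M ⇒ˢ L → ∃[ P ] N ⇒ˢ P × L ⇒ˢ P
⇒ˢ-confluent d r s = let x = meet d r s in join x , joined-⇒ˢ (joinedˡ x) , joined-⇒ˢ (joinedʳ x)

-- Environments as lists and as functions

data FromList (R : REL Env Preterm 0ℓ) : Ctx → Preterm → Set₁ where
  fromList : ∀ {Θ} → (∀ j → Θ ‼ j ≡ Γ j) → R Θ M → FromList R Γ M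

fromList-Der : ∀ {R Θ} → (∀ j → Θ ‼ j ≡ Γ j) → ⟨ R ⟩ Θ ⊢ m → Der (FromList R) Γ m
fromList-Der {Γ} {Θ = Θ} h d = go d
  where
  others : (∀ j → j ≢ i → Shared (Θ ‼ j)) → ∀ j → j ≢ i → Shared (Γ j)
  others s j j≢i = transport Shared (h j) (s j j≢i)
  go : ∀ {R} → ⟨ R ⟩ Θ ⊢ m → Der (FromList R) Γ m
  go (vl {i} e s) = vr (transport Usable (trans (sym e) (h i)) lin) (others s)
  go (vd {i} e s) = vr (transport Usable (trans (sym e) (h i)) #) (others s)
  go (va {i} e s) = vr (transport Usable (trans (sym e) (h i)) †) (others s)
  go (ap Θ₁ Θ₂ s d e) = ap (Θ₁ ‼_) (Θ₂ ‼_) (λ j → transport (Split _ _) (h j) (s j))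
    (fromList-Der (λ _ → refl) d) (fromList-Der (λ _ → refl) e)
  go (ll d)  = ll (fromList-Der (refl ▸ h) d)
  go (li₁ d) = li # (fromList-Der (refl ▸ h) d)
  go (li₂ d) = li ↓ (fromList-Der (refl ▸ h) d)
  go (lc d)  = lc (fromList-Der (refl ▸ h) d)
  go (mi Ξ u d) = mi (Ξ ‼_) (λ j → transport (Under↓ _) (h j) (u j)) (fromList-Der (λ _ → refl) d)
  go (mc Ξ u r) = mc (Ξ ‼_) (λ j → transport (Under↑ _) (h j) (u j)) (fromList (λ _ → refl) r)

⊢⇒⊩ : ∀ {Θ} → Θ ⊢ M → (Θ ‼_) ⊩ M
⊢⇒⊩ (R , step , r) = ⊩-coinduction (FromList R)
  (λ { (fromList h r) → fromList-Der h (step r) }) (fromList (λ _ → refl) r)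

-- This cuts Γ to the length of Θ. In rules (a), (mi) and (mc) the premises are empty wherever the
-- conclusion is, so nothing is cut off when Θ represents the conclusion.
listed : Env → Ctx → Env
listed []      Γ = []
listed (_ ∷ Θ) Γ = Γ zero ∷ listed Θ (Γ ∘ suc)

listed-‼ : ∀ Θ → (∀ j → Θ ‼ j ≡ nothing → Γ j ≡ nothing) → ∀ j → listed Θ Γ ‼ j ≡ Γ j
listed-‼ []      h j       = sym (h j refl)
listed-‼ (_ ∷ Θ) h zero    = refl
listed-‼ (_ ∷ Θ) h (suc j) = listed-‼ Θ (h ∘ suc) j

⊢-support : ∀ {S : REL Env Preterm (lsuc 0ℓ)} {Θ} → ⟨ S ⟩ Θ ⊢ m → Supported (λ R → ⟨ R ⟩ Θ ⊢ m) S
⊢-support (vl e s)         = support-⊥ (vl e s)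
⊢-support (vd e s)         = support-⊥ (vd e s)
⊢-support (va e s)         = support-⊥ (va e s)
⊢-support (ap Θ₁ Θ₂ s d e) =
  support-map (λ (d , e) → ap Θ₁ Θ₂ s d e) (support-× (⊢-support d) (⊢-support e))
⊢-support (ll d)           = support-map ll (⊢-support d)
⊢-support (li₁ d)          = support-map li₁ (⊢-support d)
⊢-support (li₂ d)          = support-map li₂ (⊢-support d)
⊢-support (lc d)           = support-map lc (⊢-support d)
⊢-support (mi Ξ u d)       = support-map (mi Ξ u) (⊢-support d)
⊢-support (mc Ξ u s)       = support-map (mc Ξ u) (support-leaf s)

data ToList : Env → Preterm → Set₁ where
  toList : ∀ {Θ} → (∀ j → Θ ‼ j ≡ Γ j) → Γ ⊩ M → ToList Θ M

Under↓-nothing : Under↓ π₁ nothing → π₁ ≡ nothing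
Under↓-nothing none = refl

Under↑-nothing : Under↑ π₁ nothing → π₁ ≡ nothing
Under↑-nothing none = refl

toList-⊢ : ∀ {Θ} → (∀ j → Θ ‼ j ≡ Γ j) → Γ ⊩ᴺ m → ⟨ ToList ⟩ Θ ⊢ m
toList-⊢ {Γ} {Θ = Θ} h (vr {i} u s) = go u refl
  where
  others : ∀ j → j ≢ i → Shared (Θ ‼ j)
  others j j≢i = transport Shared (sym (h j)) (s j j≢i)
  go : Usable π → Γ i ≡ π → ⟨ ToList ⟩ Θ ⊢ var i
  go lin e = vl (trans (h i) e) others
  go #   e = vd (trans (h i) e) others
  go †   e = va (trans (h i) e) others
toList-⊢ {Θ = Θ} h (ap Γ₁ Γ₂ s d e) = ap (listed Θ Γ₁) (listed Θ Γ₂) split (toList-⊢ h₁ d) (toList-⊢ h₂ e)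
  where
  h₁ : ∀ j → listed Θ Γ₁ ‼ j ≡ Γ₁ j
  h₁ = listed-‼ Θ λ j z → proj₁ (Split-nothing (transport (Split _ _) (trans (sym (h j)) z) (s j)))
  h₂ : ∀ j → listed Θ Γ₂ ‼ j ≡ Γ₂ j
  h₂ = listed-‼ Θ λ j z → proj₂ (Split-nothing (transport (Split _ _) (trans (sym (h j)) z) (s j)))
  split : ∀ j → Split (listed Θ Γ₁ ‼ j) (listed Θ Γ₂ ‼ j) (Θ ‼ j)
  split j rewrite h₁ j | h₂ j | h j = s j
toList-⊢ h (ll d)   = ll (toList-⊢ (refl ▸ h) d)
toList-⊢ h (li # d) = li₁ (toList-⊢ (refl ▸ h) d)
toList-⊢ h (li ↓ d) = li₂ (toList-⊢ (refl ▸ h) d)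
toList-⊢ h (lc d)   = lc (toList-⊢ (refl ▸ h) d)
toList-⊢ {Θ = Θ} h (mi Δ u d) = mi (listed Θ Δ) under (toList-⊢ h′ d)
  where
  h′ : ∀ j → listed Θ Δ ‼ j ≡ Δ j
  h′ = listed-‼ Θ λ j z → Under↓-nothing (transport (Under↓ _) (trans (sym (h j)) z) (u j))
  under : ∀ j → Under↓ (listed Θ Δ ‼ j) (Θ ‼ j)
  under j rewrite h′ j | h j = u j
toList-⊢ {Θ = Θ} h (mc Δ u d) = mc (listed Θ Δ) under (toList h′ d)
  where
  h′ : ∀ j → listed Θ Δ ‼ j ≡ Δ j
  h′ = listed-‼ Θ λ j z → Under↑-nothing (transport (Under↑ _) (trans (sym (h j)) z) (u j))
  under : ∀ j → Under↑ (listed Θ Δ ‼ j) (Θ ‼ j)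
  under j rewrite h′ j | h j = u j

⊩⇒⊢ : ∀ {Θ} → (∀ j → Θ ‼ j ≡ Γ j) → Γ ⊩ M → Θ ⊢ M
⊩⇒⊢ h d = ν-coinduction ToList (λ { (toList h d) → ⊢-support (toList-⊢ h (⊩-out d)) }) (toList h d)

nothing-⊳ : nothing ⊳ π → π ≡ nothing
nothing-⊳ same = refl

mainTheorem16 : (M N L : Preterm) → IsTerm M → M ⇒ N → M ⇒ L → ∃[ P ] (IsTerm P × N ⇒ P × L ⇒ P)
mainTheorem16 M N L (Θ , d) r s =
  let d′ = ⊢⇒⊩ d
      r′ = ⇒⇒⇒ˢ d′ r
      P , t , u = ⇒ˢ-confluent d′ r′ (⇒⇒⇒ˢ d′ s)
      -- P is typed as a reduct of M by way of N. Since ⊳ keeps absent variables absent, Δ fits on a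
      -- list as long as Θ.
      Δ , g , e = ⊩-⇒ˢ d′ (⇒ˢ-trans d′ r′ t)
  in P , (listed Θ Δ , ⊩⇒⊢ (listed-‼ Θ λ j z → nothing-⊳ (transport (_⊳ Δ j) z (g j))) e) ,
     ⇒ˢ⇒⇒ t , ⇒ˢ⇒⇒ u
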